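{- Let $q$ be an odd prime power, write $\mathbb{F}_q=\{0,a_1,\ldots,a_{q-1}\}$ for the finite field with $q$ elements, and let $\chi$ be the quadratic multiplicative character of $\mathbb{F}_q$. Let $$S_q=\left[(a_i^2+a_ia_j+a_j^2)\,\chi(a_i^2+a_ia_j+a_j^2)\right]_{1\le i,j\le q-1},$$ a $(q-1)\times(q-1)$ matrix over $\mathbb{F}_q$. Then there exists an element $u\in\mathbb{F}_q$ such that $$\det S_q=T_{\frac{q+1}{2}}\cdot u^2 \quad\text{in } \mathbb{F}_q,$$ where $T_{\frac{q+1}{2}}$ is the central trinomial coefficient, viewed as an element of $\mathbb{F}_q$.
   Context: The elements $a_1,\ldots,a_{q-1}$ are the nonzero elements of $\mathbb{F}_q$, listed without repetition. The quadratic character $\chi$ is defined by $\chi(0)=0$, $\chi(x)=1$ if $x$ is a nonzero square in $\mathbb{F}_q$, and $\chi(x)=-1$ otherwise; its values $0,\pm1$ are regarded as elements of $\mathbb{F}_q$. For a non-negative integer $n$, the central trinomial coefficient $T_n$ is the coefficient of $x^n$ in $(x^2+x+1)^n\in\mathbb{Z}[x]$, equivalently the constant term of $(x+1+x^{ -1})^n$. Integers are viewed in $\mathbb{F}_q$ via the canonical ring homomorphism $\mathbb{Z}\to\mathbb{F}_q$.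
   Formalization: The case q = 3 is excluded, because the claim fails there: S_3 has rows (0,1) and (1,0), so det S_3 = -1, while T_2 = 3 = 0 in F_3; the theorem is proved for every other odd prime power q. -}

module Defs where

open import Algebra.Bundles using (CommutativeRing; Semiring)
open import Data.Bool.Base using (if_then_else_)
open import Data.Fin.Base using (Fin; zero; suc; toℕ; punchIn)
import Data.Fin.Properties as Fin
open import Data.Integer.Base as ℤ using (ℤ; +_; -[1+_])
open import Data.List.Base using (List; []; _∷_; map)
open import Data.Nat.Base as ℕ using (ℕ; zero; suc)
open import Data.Nat.Divisibility using (_∣_)
open import Data.Nat.Primality using (Prime)
open import Data.Product.Base using (∃; ∃₂; _×_; _,_)
open import Function.Bundles using (Inverse)
open import Level as Level using (Level; _⊔_)
open import Relation.Binary.Definitions using (Decidable)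
open import Relation.Binary.PropositionalEquality as ≡ using (_≡_)
open import Relation.Nullary.Decidable using (Dec; does; map′)
open import Relation.Nullary.Negation using (¬_)

private variable
  c ℓ : Level

IsPrimePower : ℕ → Set
IsPrimePower q = ∃₂ λ p k → Prime p × q ≡ p ℕ.^ suc k

IsOddPrimePower : ℕ → Set
IsOddPrimePower q = IsPrimePower q × ¬ (2 ∣ q)

-- Elements of ℤ[x] as coefficient lists, constant term first; trailing zeros
-- are allowed, which does not affect coefficients.
Polynomial : Set
Polynomial = List ℤ

infixl 6 _+ₚ_
infixl 7 _*ₚ_
infixr 8 _^ₚ_

_+ₚ_ : Polynomial → Polynomial → Polynomial
[]      +ₚ g       = g
(a ∷ f) +ₚ []      = a ∷ f
(a ∷ f) +ₚ (b ∷ g) = (a ℤ.+ b) ∷ (f +ₚ g)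

_*ₚ_ : Polynomial → Polynomial → Polynomial
[]      *ₚ g = []
(a ∷ f) *ₚ g = map (a ℤ.*_) g +ₚ (ℤ.0ℤ ∷ (f *ₚ g))

_^ₚ_ : Polynomial → ℕ → Polynomial
f ^ₚ zero  = ℤ.1ℤ ∷ []
f ^ₚ suc n = f *ₚ (f ^ₚ n)

coefficient : ℕ → Polynomial → ℤ
coefficient n       []      = ℤ.0ℤ
coefficient zero    (a ∷ f) = a
coefficient (suc n) (a ∷ f) = coefficient n f

x²+x+1 : Polynomial
x²+x+1 = ℤ.1ℤ ∷ ℤ.1ℤ ∷ ℤ.1ℤ ∷ []

centralTrinomial : ℕ → ℤ
centralTrinomial n = coefficient n (x²+x+1 ^ₚ n)

module _ (R : CommutativeRing c ℓ) where
  open CommutativeRing R hiding (zero)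
  open import Algebra.Definitions.RawSemiring (Semiring.rawSemiring semiring)
    using (sum; _^_) renaming (_×_ to _·_)

  SquareMatrix : ℕ → Set c
  SquareMatrix n = Fin n → Fin n → Carrier

  -- Laplace expansion along the first row.
  determinant : ∀ {n} → SquareMatrix n → Carrier
  determinant {zero}  M = 1#
  determinant {suc n} M =
    sum λ j → (- 1#) ^ toℕ j * (M zero j * determinant λ i k → M (suc i) (punchIn j k))

  fromℤ : ℤ → Carrier
  fromℤ (+ n)    = n · 1#
  fromℤ -[1+ n ] = - (suc n · 1#)

record FiniteField (c ℓ : Level) (q : ℕ) : Set (Level.suc (c ⊔ ℓ)) where
  field
    commutativeRing : CommutativeRing c ℓ

  open CommutativeRing commutativeRing public

  field
    1≉0         : ¬ (1# ≈ 0#)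
    inverse     : ∀ x → ¬ (x ≈ 0#) → ∃ λ y → x * y ≈ 1#
    enumeration : Inverse (≡.setoid (Fin q)) setoid

module _ {q : ℕ} (F : FiniteField c ℓ q) where
  open FiniteField F
  open Inverse enumeration using (to; from; from-cong; strictlyInverseˡ)

  -- a₁, …, aₙ are the nonzero elements of F, listed without repetition.
  record ListsNonzeroElements {n : ℕ} (a : Fin n → Carrier) : Set (c ⊔ ℓ) where
    field
      nonzero   : ∀ i → ¬ (a i ≈ 0#)
      injective : ∀ {i j} → a i ≈ a j → i ≡ j
      complete  : ∀ x → ¬ (x ≈ 0#) → ∃ λ i → a i ≈ x

  IsSquare : Carrier → Set (c ⊔ ℓ)
  IsSquare x = ∃ λ y → y * y ≈ x

  _≈?_ : Decidable _≈_
  x ≈? y = map′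
    (λ eq → trans (sym (strictlyInverseˡ x))
              (trans (reflexive (≡.cong to eq)) (strictlyInverseˡ y)))
    from-cong
    (from x Fin.≟ from y)

  isSquare? : ∀ x → Dec (IsSquare x)
  isSquare? x = map′
    (λ (i , eq) → to i , eq)
    (λ (y , eq) → from y
       , trans (*-cong (strictlyInverseˡ y) (strictlyInverseˡ y)) eq)
    (Fin.any? λ i → (to i * to i) ≈? x)

  χ : Carrier → Carrier
  χ x = if does (x ≈? 0#) then 0#
        else if does (isSquare? x) then 1#
        else - 1#

  S : ∀ {n} → (Fin n → Carrier) → SquareMatrix commutativeRing n
  S a i j = Q * χ Q
    where Q = a i * a i + a i * a j + a j * a j

{-# OPTIONS --safe #-}
module Submission where

-- With n = q - 1, m = (q + 1) / 2 and Q the quadratic form, Euler's criterion gives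
-- Q χ(Q) = Q ^ m, so S has entries aⱼ² f(aᵢ / aⱼ) for f = (1 + X + X²) ^ m.  Reducing f
-- modulo Xⁿ - 1 to d₀ + … + dₙ₋₁ Xⁿ⁻¹ factors S as V D W E, where V = (aᵢˡ),
-- D = diag(dₗ), W = (aⱼ⁻ˡ) and E = diag(aⱼ²).  Orthogonality of characters gives W V = -1,
-- and n is even, so det S = ∏ dₗ · (∏ aⱼ)².  Since f is palindromic, d₁ = 2m = 1 and all
-- other factors dₗ pair up except the middle coefficient T_m of f.

open import Defs
open import Algebra.Bundles using (CommutativeRing; Semiring)
import Algebra.Definitions.RawSemiring as RawSemiringDefinitions
import Algebra.Properties.CommutativeMonoid.Sum as CommutativeMonoidSum
import Algebra.Properties.CommutativeSemiring.Exp as Exponentiation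
import Algebra.Properties.Monoid.Sum as MonoidSum
import Algebra.Properties.Ring as RingProperties
import Algebra.Properties.Semiring.Mult as SemiringMult
import Algebra.Properties.Semiring.Sum as SemiringSum
import Algebra.Solver.Ring.NaturalCoefficients.Default as SemiringSolver
open import Data.Bool.Base using (if_then_else_)
open import Data.Fin.Base using (Fin; zero; suc; toℕ; inject₁; punchIn; punchOut)
open import Data.Fin.Induction using (<-weakInduction)
open import Data.Fin.Permutation using (Permutation′; permutation)
import Data.Fin.Properties as Fin
open import Data.Integer.Base as ℤ using (+_)
import Data.Integer.Properties as ℤ
open import Data.List.Base using ([]; _∷_; map)
open import Data.Nat.Base as ℕ using (ℕ; zero; suc; z≤n; s≤s; _≤_; _<_; _∸_)
open import Data.Nat.Divisibility using (_∣_; divides)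
open import Data.Nat.DivMod using (_/_; m*n/n≡m)
import Data.Nat.Properties as ℕ
open import Data.Nat.Tactic.RingSolver using (solve-∀)
open import Data.Product.Base using (∃; _,_; proj₁; proj₂)
open import Data.Sum.Base using (_⊎_; inj₁; inj₂)
open import Data.Vec.Base as Vec using (Vec; []; _∷_)
open import Data.Vec.Functional using (head; tail; updateAt; insertAt)
  renaming (_∷_ to infixr 5 _◃_)
open import Data.Vec.Functional.Properties
  using (updateAt-updates; updateAt-minimal; insertAt-lookup; insertAt-punchIn)
import Data.Vec.Functional.Relation.Binary.Equality.Setoid as VectorEquality
open import Function.Base using (_∘_; const)
open import Function.Bundles using (Inverse)
open import Level using (_⊔_)
open import Relation.Binary.Definitions using (tri<; tri≈; tri>)
open import Relation.Binary.PropositionalEquality as ≡ using (_≡_; _≢_; _≗_)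
import Relation.Binary.Reasoning.Setoid as SetoidReasoning
open import Relation.Nullary.Decidable using (Dec; does; yes; no)
open import Relation.Nullary.Negation using (¬_; contradiction)

-- Determinants

-- The order 3 is a genuine exception: there the determinant is -1 while T_2 = 3 = 0. The degree 2m
-- = n + 2 of f exceeds n - 1 by three, so the coefficients of Xⁿ, Xⁿ⁺¹ and Xⁿ⁺² wrap round onto the
-- positions 0, 1 and 2. For the middle coefficient to survive unchanged, m must lie strictly
-- between 2 and n, that is, q ≥ 5; this is why the computation is carried out for q = 5 + 2r.
--
-- The factorisation requires the product rule for a determinant that is defined by Laplace
-- expansion. It comes from the uniqueness of alternating functions, so no sum over permutations
-- occurs. The Vandermonde determinants of V and W are never evaluated, because only det W · det V
-- enters. Nor is a primitive root needed: a bound on the number of roots of Xᵏ - 1 yields a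
-- separate witness for each nontrivial character, and the same bound gives the nonsquare case of
-- Euler's criterion.

module Determinant {c ℓ} (R : CommutativeRing c ℓ) where
  open CommutativeRing R hiding (zero)
  open RawSemiringDefinitions (Semiring.rawSemiring semiring) using (_^_; product)
  open RingProperties ring
  open SemiringSum semiring
  open SemiringSolver commutativeSemiring using (solve; _:+_; _:*_; _:=_; con)
  open VectorEquality setoid using (_≋_)
  open SetoidReasoning setoid

  Matrix : ℕ → ℕ → Set c
  Matrix m n = Fin m → Fin n → Carrier

  det : ∀ {n} → Matrix n n → Carrier
  det = determinant R

  sign : ∀ {n} → Fin n → Carrier
  sign j = (- 1#) ^ toℕ j

  minor : ∀ {m n} → Matrix (suc m) (suc n) → Fin (suc n) → Matrix m n
  minor M j i k = M (suc i) (punchIn j k)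

  δ : ∀ {n} → Matrix n n
  δ zero    zero    = 1#
  δ zero    (suc j) = 0#
  δ (suc i) zero    = 0#
  δ (suc i) (suc j) = δ i j

  infixl 7 _⊗_
  _⊗_ : ∀ {l m n} → Matrix l m → Matrix m n → Matrix l n
  (A ⊗ B) i k = sum λ j → A i j * B j k

  sum-zero : ∀ {n} {f : Fin n → Carrier} → (∀ i → f i ≈ 0#) → sum f ≈ 0#
  sum-zero {n} f≈0 = trans (sum-cong-≋ f≈0) (sum-replicate-zero n)

  sum-linear : ∀ {n} x y {f g h : Fin n → Carrier} →
    (∀ i → f i ≈ x * g i + y * h i) → sum f ≈ x * sum g + y * sum h
  sum-linear x y {f} {g} {h} eq = begin
    sum f                                    ≈⟨ sum-cong-≋ eq ⟩
    sum (λ i → x * g i + y * h i)            ≈⟨ ∑-distrib-+ (λ i → x * g i) (λ i → y * h i) ⟩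
    sum (λ i → x * g i) + sum (λ i → y * h i) ≈⟨ +-cong (*-distribˡ-sum x g) (*-distribˡ-sum y h) ⟨
    x * sum g + y * sum h                    ∎

  x+y≈0⇒x≈-y : ∀ {x y} → x + y ≈ 0# → x ≈ - y
  x+y≈0⇒x≈-y = +-inverseˡ-unique _ _

  -1*-1*x : ∀ x y → (- 1# * x) * (- 1# * y) ≈ x * y
  -1*-1*x x y = begin
    (- 1# * x) * (- 1# * y) ≈⟨ *-cong (-1*x≈-x x) (-1*x≈-x y) ⟩
    - x * - y               ≈⟨ -‿distribˡ-* x (- y) ⟨
    - (x * - y)             ≈⟨ -‿cong (-‿distribʳ-* x y) ⟨
    - - (x * y)             ≈⟨ -‿involutive _ ⟩
    x * y                   ∎

  sum-δˡ : ∀ {n} (i : Fin n) (f : Fin n → Carrier) → sum (λ k → δ i k * f k) ≈ f i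
  sum-δˡ {suc n} zero f = begin
    1# * f zero + sum (λ k → 0# * f (suc k)) ≈⟨ +-cong (*-identityˡ _) (sum-zero {n} λ k → zeroˡ (f (suc k))) ⟩
    f zero + 0#                              ≈⟨ +-identityʳ _ ⟩
    f zero                                   ∎
  sum-δˡ {suc n} (suc i) f = begin
    0# * f zero + sum (λ k → δ i k * f (suc k)) ≈⟨ +-cong (zeroˡ _) (sum-δˡ i (f ∘ suc)) ⟩
    0# + f (suc i)                              ≈⟨ +-identityˡ _ ⟩
    f (suc i)                                   ∎

  δ-sym : ∀ {n} (i j : Fin n) → δ i j ≡ δ j i
  δ-sym zero    zero    = ≡.refl
  δ-sym zero    (suc j) = ≡.refl
  δ-sym (suc i) zero    = ≡.refl
  δ-sym (suc i) (suc j) = δ-sym i j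

  δ-diagonal : ∀ {n} (i : Fin n) → δ i i ≈ 1#
  δ-diagonal zero    = refl
  δ-diagonal (suc i) = δ-diagonal i

  δ-off-diagonal : ∀ {n} {i j : Fin n} → i ≢ j → δ i j ≈ 0#
  δ-off-diagonal {i = zero}  {zero}  i≢j = contradiction ≡.refl i≢j
  δ-off-diagonal {i = zero}  {suc j} i≢j = refl
  δ-off-diagonal {i = suc i} {zero}  i≢j = refl
  δ-off-diagonal {i = suc i} {suc j} i≢j = δ-off-diagonal (i≢j ∘ ≡.cong suc)

  δ-punchIn : ∀ {n} (i : Fin (suc n)) j k → δ (punchIn i j) (punchIn i k) ≡ δ j k
  δ-punchIn zero    j       k       = ≡.refl
  δ-punchIn (suc i) zero    zero    = ≡.refl
  δ-punchIn (suc i) zero    (suc k) = ≡.refl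
  δ-punchIn (suc i) (suc j) zero    = ≡.refl
  δ-punchIn (suc i) (suc j) (suc k) = δ-punchIn i j k

  -- Vanishing on two equal rows is demanded instead of a change of sign, since the latter is weaker
  -- when 2 is a zero divisor. Linearity relates any three matrices that agree off row `i`, so that
  -- instances need not be literal row updates.
  record IsAlternating {m n} (f : Matrix m n → Carrier) : Set (c ⊔ ℓ) where
    field
      cong        : ∀ {A B} → (∀ i → A i ≋ B i) → f A ≈ f B
      linear      : ∀ i x y {A B C} →
                    (∀ k → A i k ≈ x * B i k + y * C i k) →
                    (∀ j → j ≢ i → A j ≋ B j) →
                    (∀ j → j ≢ i → A j ≋ C j) →
                    f A ≈ x * f B + y * f C
      alternating : ∀ {i j} → i ≢ j → ∀ A → A i ≋ A j → f A ≈ 0#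

    additive : ∀ i {A B C} →
               (∀ k → A i k ≈ B i k + C i k) →
               (∀ j → j ≢ i → A j ≋ B j) →
               (∀ j → j ≢ i → A j ≋ C j) →
               f A ≈ f B + f C
    additive i {A} {B} {C} eq AB AC = trans
      (linear i 1# 1#
        (λ k → trans (eq k) (sym (+-cong (*-identityˡ _) (*-identityˡ _)))) AB AC)
      (+-cong (*-identityˡ _) (*-identityˡ _))

  set-updates : ∀ {m n} (N : Matrix m n) i v → updateAt N i (const v) i ≋ v
  set-updates N i v k = reflexive (≡.cong-app (updateAt-updates i N) k)

  set-minimal : ∀ {m n} (N : Matrix m n) i v j → j ≢ i → updateAt N i (const v) j ≋ N j
  set-minimal N i v j j≢i k = reflexive (≡.cong-app (updateAt-minimal j i N j≢i) k)

  module Alternating {m n} {f : Matrix (suc m) n → Carrier} (alt : IsAlternating f) where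
    open IsAlternating alt

    private
      ≋-refl : ∀ {v : Fin n → Carrier} → v ≋ v
      ≋-refl _ = refl

    -- Polarisation: put `u + v` into both rows. The value vanishes, and so do the two terms of its
    -- expansion with equal rows; the two mixed terms are therefore opposite.
    swap : ∀ i {u v N N′} → N i ≋ v → N′ i ≋ u → (∀ k → k ≢ i → N k ≋ N′ k) →
           f (u ◃ N) ≈ - f (v ◃ N′)
    swap i {u} {v} {N} {N′} Ni≋v N′i≋u N≋N′ = begin
      f (u ◃ N)    ≈⟨ cong (λ { zero → ≋-refl ; (suc k) → N≋ k (k Fin.≟ i) }) ⟩
      g u v        ≈⟨ x+y≈0⇒x≈-y (trans (sym g-expand) g-diagonal) ⟩
      - g v u      ≈⟨ -‿cong (cong λ { zero → ≋-refl ; (suc k) → N′≋ k (k Fin.≟ i) }) ⟨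
      - f (v ◃ N′) ∎
      where
      set : (Fin n → Carrier) → Matrix m n
      set b = updateAt N i (const b)

      g : (Fin n → Carrier) → (Fin n → Carrier) → Carrier
      g a b = f (a ◃ set b)

      w : Fin n → Carrier
      w k = u k + v k

      N≋ : ∀ k → _ → N k ≋ set v k
      N≋ k (yes ≡.refl) l = trans (Ni≋v l) (sym (set-updates N i v l))
      N≋ k (no k≢i)     l = sym (set-minimal N i v k k≢i l)

      N′≋ : ∀ k → _ → N′ k ≋ set u k
      N′≋ k (yes ≡.refl) l = trans (N′i≋u l) (sym (set-updates N i u l))
      N′≋ k (no k≢i)     l = trans (sym (N≋N′ k k≢i l)) (sym (set-minimal N i u k k≢i l))

      g-diagonal′ : ∀ a → g a a ≈ 0#
      g-diagonal′ a = alternating {zero} {suc i} (λ ()) _ λ k → sym (set-updates N i a k)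

      g-diagonal : g w w ≈ 0#
      g-diagonal = g-diagonal′ w

      g-additiveʳ : ∀ a → g a w ≈ g a u + g a v
      g-additiveʳ a = additive (suc i)
        (λ k → trans (set-updates N i w k)
                 (sym (+-cong (set-updates N i u k) (set-updates N i v k))))
        (off u) (off v)
        where
        off : ∀ b j → j ≢ suc i → (a ◃ set w) j ≋ (a ◃ set b) j
        off b zero    _   l = refl
        off b (suc j) neq l = trans (set-minimal N i w j (neq ∘ ≡.cong suc) l)
                                (sym (set-minimal N i b j (neq ∘ ≡.cong suc) l))

      g-expand : g w w ≈ g u v + g v u
      g-expand = begin
        g w w                             ≈⟨ additive zero (λ _ → refl) off off ⟩
        g u w + g v w                     ≈⟨ +-cong (g-additiveʳ u) (g-additiveʳ v) ⟩
        (g u u + g u v) + (g v u + g v v) ≈⟨ +-cong (+-congʳ (g-diagonal′ u)) (+-congˡ (g-diagonal′ v)) ⟩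
        (0# + g u v) + (g v u + 0#)       ≈⟨ +-cong (+-identityˡ _) (+-identityʳ _) ⟩
        g u v + g v u                     ∎
        where
        off : ∀ {a} j → j ≢ zero → (w ◃ set w) j ≋ (a ◃ set w) j
        off zero    0≢0 = contradiction ≡.refl 0≢0
        off (suc j) _ l = refl

    linear-sum : ∀ {p} (x : Fin p → Carrier) (u : Fin p → Fin n → Carrier) {v} N →
                 (∀ k → v k ≈ sum λ j → x j * u j k) →
                 f (v ◃ N) ≈ sum λ j → x j * f (u j ◃ N)
    linear-sum {zero} x u {v} N eq = begin
      f (v ◃ N)                         ≈⟨ linear zero 0# 0# {B = v ◃ N} {v ◃ N}
                                             (λ k → trans (eq k) (sym 0x+0y)) (off _) (off _) ⟩
      0# * f (v ◃ N) + 0# * f (v ◃ N)   ≈⟨ 0x+0y ⟩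
      0#                                ∎
      where
      0x+0y : ∀ {x y} → 0# * x + 0# * y ≈ 0#
      0x+0y = trans (+-cong (zeroˡ _) (zeroˡ _)) (+-identityˡ _)
      off : ∀ a j → j ≢ zero → (v ◃ N) j ≋ (a ◃ N) j
      off a zero    0≢0 = contradiction ≡.refl 0≢0
      off a (suc j) _ l = refl
    linear-sum {suc p} x u {v} N eq = begin
      f (v ◃ N)                                   ≈⟨ linear zero (x zero) 1#
                                                       (λ k → trans (eq k) (+-congˡ (sym (*-identityˡ _)))) (off _) (off _) ⟩
      x zero * f (u zero ◃ N) + 1# * f (rest ◃ N) ≈⟨ +-congˡ (*-identityˡ _) ⟩
      x zero * f (u zero ◃ N) + f (rest ◃ N)      ≈⟨ +-congˡ (linear-sum (x ∘ suc) (u ∘ suc) N λ _ → refl) ⟩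
      (sum λ j → x j * f (u j ◃ N))               ∎
      where
      rest : Fin n → Carrier
      rest k = sum λ j → x (suc j) * u (suc j) k
      off : ∀ a j → j ≢ zero → (v ◃ N) j ≋ (a ◃ N) j
      off a zero    0≢0 = contradiction ≡.refl 0≢0
      off a (suc j) _ l = refl

    -- By linearity the difference is `x` times a value at a matrix that contains the row `u` twice.
    add-multiple-of-head : ∀ i x {u N N′} →
      (∀ k → N i k ≈ N′ i k + x * u k) → (∀ j → j ≢ i → N j ≋ N′ j) →
      f (u ◃ N) ≈ f (u ◃ N′)
    add-multiple-of-head i x {u} {N} {N′} eq N≋N′ = begin
      f (u ◃ N)                               ≈⟨ linear (suc i) 1# x
                                                   (λ k → trans (eq k) (+-cong (sym (*-identityˡ _))
                                                            (*-congˡ (sym (set-updates N′ i u k)))))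
                                                   offN offU ⟩
      1# * f (u ◃ N′) + x * f (u ◃ set)       ≈⟨ +-cong (*-identityˡ _)
                                                   (*-congˡ (alternating {zero} {suc i} (λ ()) _
                                                      λ k → sym (set-updates N′ i u k))) ⟩
      f (u ◃ N′) + x * 0#                     ≈⟨ +-congˡ (zeroʳ x) ⟩
      f (u ◃ N′) + 0#                         ≈⟨ +-identityʳ _ ⟩
      f (u ◃ N′)                              ∎
      where
      set : Matrix m n
      set = updateAt N′ i (const u)
      offN : ∀ j → j ≢ suc i → (u ◃ N) j ≋ (u ◃ N′) j
      offN zero    _   l = refl
      offN (suc j) neq l = N≋N′ j (neq ∘ ≡.cong suc) l
      offU : ∀ j → j ≢ suc i → (u ◃ N) j ≋ (u ◃ set) j
      offU zero    _   l = refl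
      offU (suc j) neq l = trans (N≋N′ j (neq ∘ ≡.cong suc) l)
                             (sym (set-minimal N′ i u j (neq ∘ ≡.cong suc) l))

  -- Rows are replaced one at a time; a row already treated is absorbed into `g`. This permits a
  -- relation `_~_` that `step` can only use in a single row.
  rowwise : ∀ {m n r} (_~_ : (Fin n → Carrier) → (Fin n → Carrier) → Set r)
    (g : Matrix m n → Carrier) →
    (∀ {A B} → (∀ i → A i ≋ B i) → g A ≈ g B) →
    (∀ i {A B} → A i ~ B i → (∀ j → j ≢ i → A j ≋ B j) → g A ≈ g B) →
    ∀ {A B} → (∀ i → A i ~ B i) → g A ≈ g B
  rowwise {zero} _~_ g g-cong step A~B = g-cong λ ()
  rowwise {suc m} _~_ g g-cong step {A} {B} A~B = begin
    g A                  ≈⟨ step zero {A} {head B ◃ tail A} (A~B zero)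
                              (λ { zero 0≢0 → contradiction ≡.refl 0≢0 ; (suc j) _ l → refl }) ⟩
    g (head B ◃ tail A)  ≈⟨ rowwise _~_ (g ∘ (head B ◃_))
                              (λ eq → g-cong λ { zero l → refl ; (suc i) → eq i })
                              (λ i Ai~Bi eq → step (suc i) Ai~Bi
                                 λ { zero _ l → refl ; (suc j) neq → eq j (neq ∘ ≡.cong suc) })
                              (A~B ∘ suc) ⟩
    g (head B ◃ tail B)  ≈⟨ g-cong (λ { zero l → refl ; (suc i) l → refl }) ⟩
    g B                  ∎

  punchIn-suc-inject₁ : ∀ {n} (i j : Fin n) → j ≢ i → punchIn (suc i) j ≡ punchIn (inject₁ i) j
  punchIn-suc-inject₁ zero    zero    j≢i = contradiction ≡.refl j≢i
  punchIn-suc-inject₁ zero    (suc j) j≢i = ≡.refl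
  punchIn-suc-inject₁ (suc i) zero    j≢i = ≡.refl
  punchIn-suc-inject₁ (suc i) (suc j) j≢i =
    ≡.cong suc (punchIn-suc-inject₁ i j (j≢i ∘ ≡.cong suc))

  punchIn-suc-self : ∀ {n} (i : Fin n) → punchIn (suc i) i ≡ inject₁ i
  punchIn-suc-self zero    = ≡.refl
  punchIn-suc-self (suc i) = ≡.cong suc (punchIn-suc-self i)

  punchIn-inject₁-self : ∀ {n} (i : Fin n) → punchIn (inject₁ i) i ≡ suc i
  punchIn-inject₁-self zero    = ≡.refl
  punchIn-inject₁-self (suc i) = ≡.cong suc (punchIn-inject₁-self i)

  -- The argument is the identity matrix with row `j` moved to the top, a cycle made of `j`
  -- transpositions. Passing from `inject₁ i` to `suc i` exchanges the top row with row `i` of the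
  -- remainder and costs one sign.
  alternating-on-cycle : ∀ {n} {f : Matrix (suc n) (suc n) → Carrier} → IsAlternating f →
    ∀ j → f (δ j ◃ (δ ∘ punchIn j)) ≈ sign j * f δ
  alternating-on-cycle {n} {f} alt = <-weakInduction _ base step
    where
    open IsAlternating alt
    open Alternating alt
    base : f (δ zero ◃ (δ ∘ suc)) ≈ 1# * f δ
    base = trans (cong λ { zero l → refl ; (suc i) l → refl }) (sym (*-identityˡ _))
    step : ∀ i → f (δ (inject₁ i) ◃ (δ ∘ punchIn (inject₁ i))) ≈ sign (inject₁ i) * f δ →
           f (δ (suc i) ◃ (δ ∘ punchIn (suc i))) ≈ sign (suc i) * f δ
    step i ih = begin
      f (δ (suc i) ◃ (δ ∘ punchIn (suc i)))
        ≈⟨ swap i (λ l → reflexive (≡.cong (λ k → δ k l) (punchIn-suc-self i)))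
                  (λ l → reflexive (≡.cong (λ k → δ k l) (punchIn-inject₁-self i)))
                  (λ k k≢i l → reflexive (≡.cong (λ p → δ p l) (punchIn-suc-inject₁ i k k≢i))) ⟩
      - f (δ (inject₁ i) ◃ (δ ∘ punchIn (inject₁ i))) ≈⟨ -‿cong ih ⟩
      - (sign (inject₁ i) * f δ)    ≈⟨ -‿cong (*-congʳ (reflexive (≡.cong ((- 1#) ^_) (Fin.toℕ-inject₁ i)))) ⟩
      - (sign i * f δ)              ≈⟨ -1*x≈-x _ ⟨
      - 1# * (sign i * f δ)         ≈⟨ *-assoc _ _ _ ⟨
      sign (suc i) * f δ            ∎

  insertAt-all : ∀ {n p} (P : Fin (suc n) → Set p) j → P j → (∀ k → P (punchIn j k)) → ∀ k → P k
  insertAt-all P j Pj Pp k with j Fin.≟ k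
  ... | yes ≡.refl = Pj
  ... | no j≢k     = ≡.subst P (Fin.punchIn-punchOut j≢k) (Pp (punchOut j≢k))

  -- Expand row 0 in unit vectors; below the row δ j, column j of the other rows can be cleared.
  alternating-unique : ∀ {n} {f : Matrix n n → Carrier} → IsAlternating f →
                       ∀ M → f M ≈ det M * f δ
  alternating-unique {zero} alt M =
    trans (IsAlternating.cong alt λ ()) (sym (*-identityˡ _))
  alternating-unique {suc n} {f} alt M = begin
    f M ≈⟨ cong (λ { zero l → refl ; (suc i) l → refl }) ⟩
    f (M zero ◃ tail M)
      ≈⟨ linear-sum (M zero) δ (tail M) (λ k → sym (trans (sum-cong-≋ λ j →
           trans (*-comm (M zero j) _) (*-congʳ (reflexive (δ-sym j k)))) (sum-δˡ k (M zero)))) ⟩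
    (sum λ j → M zero j * f (δ j ◃ tail M))
      ≈⟨ sum-cong-≋ (λ j → trans (*-congˡ (expand j)) (rearrange (M zero j) (det (minor M j)) (sign j) (f δ))) ⟩
    (sum λ j → (sign j * (M zero j * det (minor M j))) * f δ)
      ≈⟨ *-distribʳ-sum (f δ) (λ j → sign j * (M zero j * det (minor M j))) ⟨
    det M * f δ ∎
    where
    open IsAlternating alt
    open Alternating alt

    rearrange : ∀ a b c d → a * (b * (c * d)) ≈ (c * (a * b)) * d
    rearrange = solve 4 (λ a b c d → a :* (b :* (c :* d)) := (c :* (a :* b)) :* d) refl

    pad : Fin (suc n) → Matrix n n → Matrix n (suc n)
    pad j N i = insertAt (N i) j 0#

    pad-at : ∀ j N i → pad j N i j ≈ 0#
    pad-at j N i = reflexive (insertAt-lookup (N i) j 0#)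

    pad-punchIn : ∀ j N i k → pad j N i (punchIn j k) ≈ N i k
    pad-punchIn j N i k = reflexive (insertAt-punchIn (N i) j 0# k)

    pad-cong : ∀ j A B i → A i ≋ B i → pad j A i ≋ pad j B i
    pad-cong j A B i eq = insertAt-all _ j
      (trans (pad-at j A i) (sym (pad-at j B i)))
      (λ k → trans (pad-punchIn j A i k) (trans (eq k) (sym (pad-punchIn j B i k))))

    -- With the unit row `δ j` on top and a zero column inserted at `j`, `f` becomes an alternating
    -- function of the smaller block, so the induction hypothesis applies to it.
    g : Fin (suc n) → Matrix n n → Carrier
    g j N = f (δ j ◃ pad j N)

    g-alternating : ∀ j → IsAlternating (g j)
    g-alternating j = record
      { cong = λ {A} {B} eq → cong λ { zero l → refl ; (suc i) → pad-cong j A B i (eq i) }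
      ; linear = λ i x y {A} {B} {C} eq AB AC → linear (suc i) x y
          (insertAt-all _ j
            (trans (pad-at j A i) (sym (trans (+-cong
               (trans (*-congˡ (pad-at j B i)) (zeroʳ x))
               (trans (*-congˡ (pad-at j C i)) (zeroʳ y))) (+-identityˡ _))))
            (λ k → trans (pad-punchIn j A i k) (trans (eq k) (sym
               (+-cong (*-congˡ (pad-punchIn j B i k)) (*-congˡ (pad-punchIn j C i k)))))))
          (λ { zero _ l → refl ; (suc k) neq → pad-cong j A B k (AB k (neq ∘ ≡.cong suc)) })
          (λ { zero _ l → refl ; (suc k) neq → pad-cong j A C k (AC k (neq ∘ ≡.cong suc)) })
      ; alternating = λ {i} {i′} i≢i′ A eq →
          alternating {suc i} {suc i′} (i≢i′ ∘ Fin.suc-injective) _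
            (insertAt-all _ j
              (trans (pad-at j A i) (sym (pad-at j A i′)))
              (λ k → trans (pad-punchIn j A i k) (trans (eq k) (sym (pad-punchIn j A i′ k)))))
      }

    g-δ : ∀ j → g j δ ≈ sign j * f δ
    g-δ j = trans
      (cong λ { zero l → refl
              ; (suc i) → insertAt-all _ j
                  (trans (pad-at j δ i) (sym (δ-off-diagonal (Fin.punchInᵢ≢i j i))))
                  (λ k → trans (pad-punchIn j δ i k) (sym (reflexive (δ-punchIn j i k)))) })
      (alternating-on-cycle alt j)

    clear-column : ∀ j → f (δ j ◃ tail M) ≈ g j (minor M j)
    clear-column j = rowwise
      -- The multiple of `δ j` to be removed from a row is its own entry in column `j`, which leaves
      -- 0 there and changes nothing else.
      (λ v w → ∀ k → v k ≈ w k + v j * δ j k)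
      (λ N → f (δ j ◃ N))
      (λ eq → cong λ { zero l → refl ; (suc i) → eq i })
      (λ i {A} {B} eq → add-multiple-of-head i (A i j) eq)
      (λ i → insertAt-all _ j
        (sym (trans (+-cong (pad-at j (minor M j) i) (trans (*-congˡ (δ-diagonal j)) (*-identityʳ _)))
                (+-identityˡ _)))
        (λ k → sym (trans (+-cong (pad-punchIn j (minor M j) i k)
                      (trans (*-congˡ (δ-off-diagonal (Fin.punchInᵢ≢i j k ∘ ≡.sym))) (zeroʳ _)))
                      (+-identityʳ _))))

    expand : ∀ j → f (δ j ◃ tail M) ≈ det (minor M j) * (sign j * f δ)
    expand j = begin
      f (δ j ◃ tail M)                 ≈⟨ clear-column j ⟩
      g j (minor M j)                  ≈⟨ alternating-unique (g-alternating j) (minor M j) ⟩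
      det (minor M j) * g j δ          ≈⟨ *-congˡ (g-δ j) ⟩
      det (minor M j) * (sign j * f δ) ∎

  -- The terms (0 , k) and (suc k , 0) cancel; the others form the same sum in lower dimension.
  double-expansion : ∀ {n} (v : Fin (2 ℕ.+ n) → Carrier) (H : (Fin n → Fin (2 ℕ.+ n)) → Carrier) →
    (∀ {φ ψ} → φ ≗ ψ → H φ ≈ H ψ) →
    (sum λ j → sign j * (v j *
      sum λ k → sign k * (v (punchIn j k) * H (punchIn j ∘ punchIn k)))) ≈ 0#
  double-expansion {n} v H H-cong = begin
    1# * (v zero * first) + sum (λ j → sign (suc j) * (v (suc j) * inner j))
      ≈⟨ +-cong (trans (*-identityˡ _) (*-distribˡ-sum (v zero) (λ k → sign k * (v (suc k) * H (suc ∘ punchIn k)))))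
                (sum-cong-≋ split) ⟩
    sum (λ k → v zero * firstTerm k) + sum (λ j → - (v zero * firstTerm j) + rest j)
      ≈⟨ +-congˡ (∑-distrib-+ (λ j → - (v zero * firstTerm j)) rest) ⟩
    sum (λ k → v zero * firstTerm k) + (sum (λ j → - (v zero * firstTerm j)) + sum rest)
      ≈⟨ +-assoc _ _ _ ⟨
    (sum (λ k → v zero * firstTerm k) + sum (λ j → - (v zero * firstTerm j))) + sum rest
      ≈⟨ +-cong (trans (sym (∑-distrib-+ (λ j → v zero * firstTerm j) (λ j → - (v zero * firstTerm j))))
                   (sum-zero {suc n} (λ j → -‿inverseʳ (v zero * firstTerm j))))
                (rest≈0 v H H-cong) ⟩
    0# + 0# ≈⟨ +-identityˡ _ ⟩
    0# ∎
    where
    firstTerm : Fin (suc n) → Carrier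
    firstTerm k = sign k * (v (suc k) * H (suc ∘ punchIn k))

    first : Carrier
    first = sum firstTerm

    remaining : ∀ {n} (v : Fin (2 ℕ.+ n) → Carrier) (H : (Fin n → Fin (2 ℕ.+ n)) → Carrier) →
                Fin (suc n) → Fin n → Carrier
    remaining v H j k = sign (suc k) * (v (suc (punchIn j k)) * H (punchIn (suc j) ∘ punchIn (suc k)))

    inner : Fin (suc n) → Carrier
    inner j = 1# * (v zero * H (punchIn (suc j) ∘ suc)) + sum (remaining v H j)

    rest : Fin (suc n) → Carrier
    rest j = sign (suc j) * (v (suc j) * sum (remaining v H j))

    split : ∀ j → sign (suc j) * (v (suc j) * inner j) ≈ - (v zero * firstTerm j) + rest j
    split j = begin
      sign (suc j) * (v (suc j) * inner j)
        ≈⟨ expand (- 1#) (sign j) (v (suc j)) (v zero) (H (suc ∘ punchIn j)) (sum (remaining v H j)) ⟩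
      - 1# * (v zero * firstTerm j) + rest j
        ≈⟨ +-congʳ (-1*x≈-x _) ⟩
      - (v zero * firstTerm j) + rest j ∎
      where
      expand : ∀ e s w u h r → (e * s) * (w * (1# * (u * h) + r)) ≈ e * (u * (s * (w * h))) + (e * s) * (w * r)
      expand = solve 6 (λ e s w u h r →
        (e :* s) :* (w :* (con 1 :* (u :* h) :+ r)) := e :* (u :* (s :* (w :* h))) :+ (e :* s) :* (w :* r))
        refl

    -- Column 0 is never deleted in these terms. Once it is absorbed into `H′`, what remains is the
    -- double sum for `v ∘ suc`; the factor -1 from `sign (suc j)` cancels the one from
    -- `sign (suc k)`.
    rest≈0 : ∀ {n} (v : Fin (2 ℕ.+ n) → Carrier) (H : (Fin n → Fin (2 ℕ.+ n)) → Carrier) →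
      (∀ {φ ψ} → φ ≗ ψ → H φ ≈ H ψ) →
      (sum λ j → sign (suc j) * (v (suc j) * sum (remaining v H j))) ≈ 0#
    rest≈0 {zero}  v H H-cong = sum-zero {1} λ j → trans (*-congˡ (zeroʳ (v (suc j)))) (zeroʳ (sign (suc j)))
    rest≈0 {suc n} v H H-cong = begin
      (sum λ j → sign (suc j) * (v (suc j) * sum (remaining v H j)))
        ≈⟨ sum-cong-≋ (λ j → simplify j) ⟩
      (sum λ j → sign j * (v (suc j) *
        sum λ k → sign k * (v (suc (punchIn j k)) * H′ (punchIn j ∘ punchIn k))))
        ≈⟨ double-expansion (v ∘ suc) H′ (λ eq → H-cong λ { zero → ≡.refl ; (suc i) → ≡.cong suc (eq i) }) ⟩
      0# ∎
      where
      H′ : (Fin n → Fin (2 ℕ.+ n)) → Carrier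
      H′ φ = H λ { zero → zero ; (suc l) → suc (φ l) }

      term : Fin (2 ℕ.+ n) → Fin (suc n) → Carrier
      term j k = sign k * (v (suc (punchIn j k)) * H′ (punchIn j ∘ punchIn k))

      negated-sum : ∀ j → sum (remaining v H j) ≈ - 1# * sum (term j)
      negated-sum j = trans
        (sum-cong-≋ {suc n} {remaining v H j} {λ k → - 1# * term j k} λ k →
           trans (*-assoc (- 1#) (sign k) _)
             (*-congˡ (*-congˡ (*-congˡ (H-cong λ { zero → ≡.refl ; (suc l) → ≡.refl })))))
        (sym (*-distribˡ-sum (- 1#) (term j)))

      simplify : ∀ j → sign (suc j) * (v (suc j) * sum (remaining v H j)) ≈
                       sign j * (v (suc j) * sum (term j))
      simplify j = begin
        (- 1# * sign j) * (v (suc j) * sum (remaining v H j))     ≈⟨ *-congˡ (*-congˡ (negated-sum j)) ⟩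
        (- 1# * sign j) * (v (suc j) * (- 1# * sum (term j)))     ≈⟨ pull (- 1#) (sign j) (v (suc j)) (sum (term j)) ⟩
        (- 1# * sign j) * (- 1# * (v (suc j) * sum (term j)))     ≈⟨ -1*-1*x (sign j) _ ⟩
        sign j * (v (suc j) * sum (term j))                       ∎
        where
        pull : ∀ e s w t → (e * s) * (w * (e * t)) ≈ (e * s) * (e * (w * t))
        pull = solve 4 (λ e s w t → (e :* s) :* (w :* (e :* t)) := (e :* s) :* (e :* (w :* t))) refl

  -- The Laplace expansion is alternating

  det-cong : ∀ {n} {A B : Matrix n n} → (∀ i → A i ≋ B i) → det A ≈ det B
  det-cong {zero}  eq = refl
  det-cong {suc n} eq = sum-cong-≋ λ j →
    *-congˡ {sign j} (*-cong (eq zero j) (det-cong λ i k → eq (suc i) (punchIn j k)))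

  det-linear : ∀ {n} i x y {A B C : Matrix n n} →
    (∀ k → A i k ≈ x * B i k + y * C i k) →
    (∀ j → j ≢ i → A j ≋ B j) →
    (∀ j → j ≢ i → A j ≋ C j) →
    det A ≈ x * det B + y * det C
  det-linear {suc n} zero x y {A} {B} {C} eq AB AC = sum-linear x y λ j → begin
    sign j * (A zero j * det (minor A j))
      ≈⟨ *-congˡ (*-congʳ (eq j)) ⟩
    sign j * ((x * B zero j + y * C zero j) * det (minor A j))
      ≈⟨ expand (sign j) x y (B zero j) (C zero j) (det (minor A j)) ⟩
    x * (sign j * (B zero j * det (minor A j))) + y * (sign j * (C zero j * det (minor A j)))
      ≈⟨ +-cong (*-congˡ (*-congˡ (*-congˡ (det-cong λ i k → AB (suc i) (λ ()) (punchIn j k)))))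
                (*-congˡ (*-congˡ (*-congˡ (det-cong λ i k → AC (suc i) (λ ()) (punchIn j k))))) ⟩
    x * (sign j * (B zero j * det (minor B j))) + y * (sign j * (C zero j * det (minor C j))) ∎
    where
    expand : ∀ s x y b c d → s * ((x * b + y * c) * d) ≈ x * (s * (b * d)) + y * (s * (c * d))
    expand = solve 6 (λ s x y b c d →
      s :* ((x :* b :+ y :* c) :* d) := x :* (s :* (b :* d)) :+ y :* (s :* (c :* d))) refl
  det-linear {suc n} (suc i) x y {A} {B} {C} eq AB AC = sum-linear x y λ j → begin
    sign j * (A zero j * det (minor A j))
      ≈⟨ *-congˡ (*-congˡ (det-linear i x y {minor A j} {minor B j} {minor C j}
           (λ k → eq (punchIn j k))
           (λ l l≢i k → AB (suc l) (l≢i ∘ Fin.suc-injective) (punchIn j k))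
           (λ l l≢i k → AC (suc l) (l≢i ∘ Fin.suc-injective) (punchIn j k)))) ⟩
    sign j * (A zero j * (x * det (minor B j) + y * det (minor C j)))
      ≈⟨ expand (sign j) x y (A zero j) (det (minor B j)) (det (minor C j)) ⟩
    x * (sign j * (A zero j * det (minor B j))) + y * (sign j * (A zero j * det (minor C j)))
      ≈⟨ +-cong (*-congˡ (*-congˡ (*-congʳ (AB zero (λ ()) j))))
                (*-congˡ (*-congˡ (*-congʳ (AC zero (λ ()) j)))) ⟩
    x * (sign j * (B zero j * det (minor B j))) + y * (sign j * (C zero j * det (minor C j))) ∎
    where
    expand : ∀ s x y a b c → s * (a * (x * b + y * c)) ≈ x * (s * (a * b)) + y * (s * (a * c))
    expand = solve 6 (λ s x y a b c →
      s :* (a :* (x :* b :+ y :* c)) := x :* (s :* (a :* b)) :+ y :* (s :* (a :* c))) refl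

  -- Expansion along both rows leaves minors that depend only on the embedding of the remaining
  -- columns, which is the argument of `H` in `double-expansion`.
  det-first-two-rows : ∀ {n} (A : Matrix (2 ℕ.+ n) (2 ℕ.+ n)) → A zero ≋ A (suc zero) → det A ≈ 0#
  det-first-two-rows A eq = begin
    det A
      ≈⟨ sum-cong-≋ (λ j → *-congˡ {sign j} (*-congˡ {A zero j} (sum-cong-≋ λ k →
           *-congˡ {sign k} (*-congʳ {det (λ i l → A (suc (suc i)) (punchIn j (punchIn k l)))} (sym (eq (punchIn j k))))))) ⟩
    _ ≈⟨ double-expansion (A zero) (λ φ → det λ i k → A (suc (suc i)) (φ k))
           (λ eq → det-cong λ i k → reflexive (≡.cong (A (suc (suc i))) (eq k))) ⟩
    0# ∎

  -- Equal rows below row 0 occur in every minor, so induction settles them; rows 0 and 1 are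
  -- settled by the double expansion. If row 0 equals a later row, that row is first exchanged with
  -- row 1: the exchange happens inside every minor, where the induction hypothesis supplies the
  -- sign.
  det-isAlternating : ∀ n → IsAlternating (det {n})
  det-isAlternating zero = record
    { cong = det-cong ; linear = det-linear ; alternating = λ { {()} } }
  det-isAlternating (suc n) = record
    { cong = det-cong ; linear = det-linear ; alternating = λ {i} {j} → alternating i j }
    where
    first-row : ∀ {n} → IsAlternating (det {n}) → (j : Fin n) →
                ∀ A → A zero ≋ A (suc j) → det A ≈ 0#
    first-row alt zero A eq = det-first-two-rows A eq
    first-row {suc n} alt (suc j) A eq = begin
      det A      ≈⟨ trans (sum-cong-≋ λ k → trans (*-congˡ {sign k} (*-congˡ (swapped k))) (negate (A zero k) (det (minor A′ k)) (sign k) (- 1#)))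
                      (sym (*-distribˡ-sum (- 1#) (λ k → sign k * (A zero k * det (minor A′ k))))) ⟩
      - 1# * det A′ ≈⟨ *-congˡ (det-first-two-rows A′ eq) ⟩
      - 1# * 0#   ≈⟨ zeroʳ _ ⟩
      0#         ∎
      where
      N : Matrix n (2 ℕ.+ n)
      N = tail (tail A)

      A′ : Matrix (2 ℕ.+ n) (2 ℕ.+ n)
      A′ = A zero ◃ (A (suc (suc j)) ◃ updateAt N j (const (A (suc zero))))

      negate : ∀ a d s e → s * (a * (e * d)) ≈ e * (s * (a * d))
      negate = solve 4 (λ a d s e → s :* (a :* (e :* d)) := e :* (s :* (a :* d))) refl

      swapped : ∀ k → det (minor A k) ≈ - 1# * det (minor A′ k)
      swapped k = begin
        det (minor A k)
          ≈⟨ det-cong {A = minor A k} {head (minor A k) ◃ tail (minor A k)} (λ { zero l → refl ; (suc i) l → refl }) ⟩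
        det (head (minor A k) ◃ tail (minor A k))
          ≈⟨ Alternating.swap alt j {head (minor A k)} {λ l → A (suc (suc j)) (punchIn k l)} {tail (minor A k)}
               {λ i l → updateAt N j (const (A (suc zero))) i (punchIn k l)}
               (λ l → refl)
               (λ l → set-updates N j (A (suc zero)) (punchIn k l))
               (λ i i≢j l → sym (set-minimal N j (A (suc zero)) i i≢j (punchIn k l))) ⟩
        - det swapped-minor
          ≈⟨ -‿cong (det-cong {A = swapped-minor} {B = minor A′ k} λ { zero l → refl ; (suc i) l → refl }) ⟩
        - det (minor A′ k) ≈⟨ -1*x≈-x _ ⟨
        - 1# * det (minor A′ k) ∎
        where
        swapped-minor : Matrix (suc n) (suc n)
        swapped-minor = (λ l → A (suc (suc j)) (punchIn k l)) ◃
                        λ i l → updateAt N j (const (A (suc zero))) i (punchIn k l)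

    alternating : ∀ i j → i ≢ j → ∀ A → A i ≋ A j → det A ≈ 0#
    alternating zero    zero    i≢j A eq = contradiction ≡.refl i≢j
    alternating zero    (suc j) i≢j A eq = first-row (det-isAlternating n) j A eq
    alternating (suc i) zero    i≢j A eq = first-row (det-isAlternating n) i A (λ k → sym (eq k))
    alternating (suc i) (suc j) i≢j A eq = sum-zero {suc n} λ k → begin
      sign k * (A zero k * det (minor A k))
        ≈⟨ *-congˡ {sign k} (*-congˡ (IsAlternating.alternating (det-isAlternating n)
             (i≢j ∘ ≡.cong suc) (minor A k) (λ l → eq (punchIn k l)))) ⟩
      sign k * (A zero k * 0#)  ≈⟨ *-congˡ (zeroʳ _) ⟩
      sign k * 0#               ≈⟨ zeroʳ _ ⟩
      0#                        ∎

  -- Product rule and diagonal matrices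

  ⊗-identityˡ : ∀ {m n} (A : Matrix m n) i → (δ ⊗ A) i ≋ A i
  ⊗-identityˡ A i k = sum-δˡ i (λ j → A j k)

  -- For fixed `B`, the function sending `A` to `det (A ⊗ B)` is alternating in the rows of `A`,
  -- hence it is `det A` times its value at the identity.
  det-⊗ : ∀ {n} (A B : Matrix n n) → det (A ⊗ B) ≈ det A * det B
  det-⊗ {n} A B = trans (alternating-unique isAlternating A) (*-congˡ (det-cong (⊗-identityˡ B)))
    where
    open IsAlternating (det-isAlternating n)
    ⊗-congʳ : ∀ {A A′} i → A i ≋ A′ i → (A ⊗ B) i ≋ (A′ ⊗ B) i
    ⊗-congʳ i eq k = sum-cong-≋ λ j → *-congʳ (eq j)
    expand : ∀ x y a b c → (x * a + y * b) * c ≈ x * (a * c) + y * (b * c)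
    expand = solve 5 (λ x y a b c → (x :* a :+ y :* b) :* c := x :* (a :* c) :+ y :* (b :* c)) refl
    isAlternating : IsAlternating (λ A → det (A ⊗ B))
    isAlternating = record
      { cong = λ {A} {A′} eq → cong λ i → ⊗-congʳ {A} {A′} i (eq i)
      ; linear = λ i x y {A} {C} {D} eq AC AD → linear i x y
          (λ k → sum-linear x y λ j → trans (*-congʳ (eq j)) (expand x y (C i j) (D i j) (B j k)))
          (λ j j≢i → ⊗-congʳ {A} {C} j (AC j j≢i))
          (λ j j≢i → ⊗-congʳ {A} {D} j (AD j j≢i))
      ; alternating = λ i≢j A eq → alternating i≢j (A ⊗ B) λ k → sum-cong-≋ λ l → *-congʳ (eq l)
      }

  diagonal : ∀ {n} → (Fin n → Carrier) → Matrix n n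
  diagonal d i j = d i * δ i j

  det-diagonal : ∀ {n} (d : Fin n → Carrier) → det (diagonal d) ≈ product d
  det-diagonal {zero}  d = refl
  det-diagonal {suc n} d = begin
    1# * ((d zero * 1#) * det (diagonal (d ∘ suc))) + sum (λ j → sign (suc j) * ((d zero * 0#) * det (minor (diagonal d) (suc j))))
      ≈⟨ +-cong (trans (*-identityˡ _) (*-cong (*-identityʳ _) (det-diagonal (d ∘ suc))))
                (sum-zero {n} λ j → trans (*-congˡ (trans (*-congʳ (zeroʳ _)) (zeroˡ _))) (zeroʳ (sign (suc j)))) ⟩
    product d + 0# ≈⟨ +-identityʳ _ ⟩
    product d ∎

  ⊗-diagonal : ∀ {m n} (A : Matrix m n) d i k → (A ⊗ diagonal d) i k ≈ A i k * d k
  ⊗-diagonal A d i k = begin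
    (sum λ j → A i j * (d j * δ j k)) ≈⟨ sum-cong-≋ (λ j → trans (sym (*-assoc _ _ _))
                                           (trans (*-comm _ _) (*-congʳ (reflexive (δ-sym j k))))) ⟩
    (sum λ j → δ k j * (A i j * d j)) ≈⟨ sum-δˡ k (λ j → A i j * d j) ⟩
    A i k * d k                       ∎

-- Trinomial coefficients

-- The coefficient of xᵏ in (1 + x + x²)ᵐ by the three-term Pascal rule. The small cases of `k` are
-- separate because some of the three terms fall outside the triangle.
trinomial : ℕ → ℕ → ℕ
trinomial zero    zero          = 1
trinomial zero    (suc k)       = 0
trinomial (suc m) zero          = trinomial m 0
trinomial (suc m) (suc zero)    = trinomial m 1 ℕ.+ trinomial m 0
trinomial (suc m) (suc (suc k)) =
  trinomial m (2 ℕ.+ k) ℕ.+ (trinomial m (1 ℕ.+ k) ℕ.+ trinomial m k)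

coefficient-+ₚ : ∀ k f g → coefficient k (f +ₚ g) ≡ coefficient k f ℤ.+ coefficient k g
coefficient-+ₚ k       []      g       = ≡.sym (ℤ.+-identityˡ _)
coefficient-+ₚ k       (a ∷ f) []      = ≡.sym (ℤ.+-identityʳ _)
coefficient-+ₚ zero    (a ∷ f) (b ∷ g) = ≡.refl
coefficient-+ₚ (suc k) (a ∷ f) (b ∷ g) = coefficient-+ₚ k f g

coefficient-1* : ∀ k f → coefficient k (map (ℤ.1ℤ ℤ.*_) f) ≡ coefficient k f
coefficient-1* k       []      = ≡.refl
coefficient-1* zero    (a ∷ f) = ℤ.*-identityˡ a
coefficient-1* (suc k) (a ∷ f) = coefficient-1* k f

coefficient-0 : ∀ k → coefficient k (ℤ.0ℤ ∷ []) ≡ ℤ.0ℤ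
coefficient-0 zero    = ≡.refl
coefficient-0 (suc k) = ≡.refl

coefficient-trinomial : ∀ m k → coefficient k (x²+x+1 ^ₚ m) ≡ + trinomial m k
coefficient-trinomial zero    zero    = ≡.refl
coefficient-trinomial zero    (suc k) = ≡.refl
coefficient-trinomial (suc m) k       = go k
  where
  f = x²+x+1 ^ₚ m
  1f = map (ℤ.1ℤ ℤ.*_) f

  add : ∀ k g {y} → coefficient k g ≡ y → coefficient k (1f +ₚ g) ≡ + trinomial m k ℤ.+ y
  add k g eq = ≡.trans (coefficient-+ₚ k 1f g)
    (≡.cong₂ ℤ._+_ (≡.trans (coefficient-1* k f) (coefficient-trinomial m k)) eq)

  go : ∀ k → coefficient k (x²+x+1 *ₚ f) ≡ + trinomial (suc m) k
  -- The product unfolds to three copies of `1f`, shifted by 0, 1 and 2, followed by the zero that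
  -- `[] *ₚ f` leaves behind.
  go zero          = ≡.trans (add 0 _ ≡.refl) (ℤ.+-identityʳ (+ trinomial m 0))
  go (suc zero)    = add 1 _ (≡.trans (add 0 _ ≡.refl) (ℤ.+-identityʳ (+ trinomial m 0)))
  go (suc (suc k)) = add (2 ℕ.+ k) _ (add (1 ℕ.+ k) _
    (≡.trans (add k _ (coefficient-0 k)) (ℤ.+-identityʳ (+ trinomial m k))))

centralTrinomial-trinomial : ∀ m → centralTrinomial m ≡ + trinomial m m
centralTrinomial-trinomial m = coefficient-trinomial m m

trinomial-0 : ∀ m → trinomial m 0 ≡ 1
trinomial-0 zero    = ≡.refl
trinomial-0 (suc m) = trinomial-0 m

trinomial-1 : ∀ m → trinomial m 1 ≡ m
trinomial-1 zero    = ≡.refl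
trinomial-1 (suc m) = ≡.trans (≡.cong₂ ℕ._+_ (trinomial-1 m) (trinomial-0 m)) (ℕ.+-comm m 1)

trinomial-vanishes : ∀ m k → m ℕ.+ m < k → trinomial m k ≡ 0
trinomial-vanishes zero    (suc k)       _   = ≡.refl
trinomial-vanishes (suc m) (suc zero)    (s≤s ())
trinomial-vanishes (suc m) (suc (suc k)) 2m<k = ≡.cong₂ ℕ._+_
  (trinomial-vanishes m (2 ℕ.+ k) (ℕ.m<n⇒m<1+n (ℕ.m<n⇒m<1+n bound)))
  (≡.cong₂ ℕ._+_ (trinomial-vanishes m (1 ℕ.+ k) (ℕ.m<n⇒m<1+n bound)) (trinomial-vanishes m k bound))
  where
  bound : m ℕ.+ m < k
  bound = ℕ.≤-pred (≡.subst (_< suc k) (ℕ.+-suc m m) (ℕ.≤-pred 2m<k))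

-- The three-term rule is invariant under reversal, so the symmetry passes from `m` to `suc m`. Near
-- the edges the terms missing on one side match terms beyond degree 2m on the other, which vanish.
-- The hypothesis on `k + l` avoids truncated subtraction.
trinomial-sym : ∀ m k l → k ℕ.+ l ≡ m ℕ.+ m → trinomial m k ≡ trinomial m l
trinomial-sym zero zero zero _ = ≡.refl
trinomial-sym (suc m) k l eq = go k l (≡.trans eq (≡.cong suc (ℕ.+-suc m m)))
  where
  edge₀ : ∀ l → l ≡ m ℕ.+ m → trinomial (suc m) 0 ≡ trinomial (suc m) (2 ℕ.+ l)
  edge₀ l ≡.refl = ≡.trans (trinomial-sym m 0 l ≡.refl) (≡.sym (≡.cong₂ ℕ._+_
    (trinomial-vanishes m (2 ℕ.+ l) (ℕ.m<n⇒m<1+n (ℕ.n<1+n l)))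
    (≡.cong (ℕ._+ trinomial m l) (trinomial-vanishes m (1 ℕ.+ l) (ℕ.n<1+n l)))))

  edge₁ : ∀ l → suc l ≡ m ℕ.+ m → trinomial (suc m) 1 ≡ trinomial (suc m) (2 ℕ.+ l)
  edge₁ l eq = ≡.trans
    (≡.trans (ℕ.+-comm (trinomial m 1) _)
      (≡.cong₂ ℕ._+_ (trinomial-sym m 0 (suc l) eq) (trinomial-sym m 1 l eq)))
    (≡.cong (ℕ._+ (trinomial m (1 ℕ.+ l) ℕ.+ trinomial m l)) (≡.sym (trinomial-vanishes m (2 ℕ.+ l) (ℕ.≤-reflexive (≡.cong suc (≡.sym eq))))))

  go : ∀ k l → k ℕ.+ l ≡ suc (suc (m ℕ.+ m)) → trinomial (suc m) k ≡ trinomial (suc m) l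
  go zero          (suc (suc l)) eq = edge₀ l (ℕ.suc-injective (ℕ.suc-injective eq))
  go (suc zero)    (suc zero)    eq = ≡.refl
  go (suc zero)    (suc (suc l)) eq = edge₁ l (ℕ.suc-injective (ℕ.suc-injective eq))
  go (suc (suc k)) zero          eq =
    ≡.sym (edge₀ k (≡.trans (≡.sym (ℕ.+-identityʳ k)) (ℕ.suc-injective (ℕ.suc-injective eq))))
  go (suc (suc k)) (suc zero)    eq =
    ≡.sym (edge₁ k (≡.trans (ℕ.+-comm 1 k) (ℕ.suc-injective (ℕ.suc-injective eq))))
  go (suc (suc k)) (suc (suc l)) eq = ≡.trans
    (≡.cong₂ ℕ._+_ (trinomial-sym m (2 ℕ.+ k) l (≡.trans (≡.sym k+2+l) k+[2+l]))
      (≡.cong₂ ℕ._+_ (trinomial-sym m (1 ℕ.+ k) (1 ℕ.+ l) (≡.trans (≡.sym (ℕ.+-suc k (suc l))) k+[2+l]))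
        (trinomial-sym m k (2 ℕ.+ l) k+[2+l])))
    (reverse (trinomial m l) (trinomial m (1 ℕ.+ l)) (trinomial m (2 ℕ.+ l)))
    where
    k+[2+l] : k ℕ.+ (2 ℕ.+ l) ≡ m ℕ.+ m
    k+[2+l] = ℕ.suc-injective (ℕ.suc-injective eq)
    k+2+l : k ℕ.+ (2 ℕ.+ l) ≡ 2 ℕ.+ (k ℕ.+ l)
    k+2+l = ≡.trans (ℕ.+-suc k (suc l)) (≡.cong suc (ℕ.+-suc k l))
    reverse : ∀ a b c → a ℕ.+ (b ℕ.+ c) ≡ c ℕ.+ (b ℕ.+ a)
    reverse a b c = ≡.trans (ℕ.+-comm a _) (≡.trans (≡.cong (ℕ._+ a) (ℕ.+-comm b c)) (ℕ.+-assoc c b a))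

-- Evaluation, wrapping and palindromic products

module TrinomialExpansion {c ℓ} (R : CommutativeRing c ℓ) where
  open CommutativeRing R hiding (zero)
  open RawSemiringDefinitions (Semiring.rawSemiring semiring) using (_^_; product)
  open Determinant R
  open SemiringSum semiring
  open SemiringMult semiring
  open SemiringSolver commutativeSemiring using (solve; _:+_; _:*_; _:=_; con)
  open SetoidReasoning setoid
  private module Product = MonoidSum *-monoid

  evaluate : (ℕ → Carrier) → ℕ → Carrier → Carrier
  evaluate f N y = sum {N} λ k → f (toℕ k) * y ^ toℕ k

  evaluate-last : ∀ f N y → evaluate f (suc N) y ≈ evaluate f N y + f N * y ^ N
  evaluate-last f N y = trans (sum-init-last term) (+-cong
    (sum-cong-≋ {N} λ k → reflexive (≡.cong (λ i → f i * y ^ i) (Fin.toℕ-inject₁ k)))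
    (reflexive (≡.cong (λ i → f i * y ^ i) (Fin.toℕ-fromℕ N))))
    where
    term : Fin (suc N) → Carrier
    term k = f (toℕ k) * y ^ toℕ k

  -- The length `N` may be any number above the degree: the rule splits the sum into three shifted
  -- ones of lengths `2 + N`, `1 + N` and `N`, and the induction hypothesis must cover all of them.
  evaluate-trinomial : ∀ m N y → m ℕ.+ m < N →
    evaluate (λ k → trinomial m k × 1#) N y ≈ (1# + (y + y * y)) ^ m
  evaluate-trinomial zero (suc N) y _ = begin
    (1# + 0#) * 1# + sum {N} (λ k → 0# * y ^ suc (toℕ k))
      ≈⟨ +-cong (trans (*-identityʳ _) (+-identityʳ _)) (sum-zero {N} λ k → zeroˡ (y ^ suc (toℕ k))) ⟩
    1# + 0# ≈⟨ +-identityʳ _ ⟩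
    1#      ∎
  evaluate-trinomial (suc m) (suc zero) y (s≤s ())
  evaluate-trinomial (suc m) (suc (suc N)) y 2m<N = begin
    t 0 * 1# + (ι (trinomial m 1 ℕ.+ trinomial m 0) * (y * 1#) + sum {N} (λ k → ι (trinomial (suc m) (2 ℕ.+ toℕ k)) * (y * (y * p k))))
      ≈⟨ +-congˡ (+-cong (*-congʳ (×-homo-+ 1# (trinomial m 1) (trinomial m 0)))
           (trans (sum-cong-≋ {N} λ k → trans
                     (*-congʳ (trans (×-homo-+ 1# (trinomial m (2 ℕ.+ toℕ k)) _)
                                (+-congˡ (×-homo-+ 1# (trinomial m (1 ℕ.+ toℕ k)) (trinomial m (toℕ k))))))
                     (spread (t (2 ℕ.+ toℕ k)) (t (1 ℕ.+ toℕ k)) (t (toℕ k)) y (p k)))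
           (trans (∑-distrib-+ A (λ k → y * B k + (y * y) * C k))
             (+-congˡ (sum-linear {N} y (y * y) {λ k → y * B k + (y * y) * C k} {B} {C} λ _ → refl))))) ⟩
    t 0 * 1# + ((t 1 + t 0) * (y * 1#) + (sum A + (y * sum B + (y * y) * sum C)))
      ≈⟨ regroup (t 0) (t 1) y (sum A) (sum B) (sum C) ⟩
    (t 0 * 1# + (t 1 * (y * 1#) + sum A)) + (y * (t 0 * 1# + sum B) + (y * y) * sum C)
      ≈⟨ +-cong (evaluate-trinomial m (2 ℕ.+ N) y (ℕ.m<n⇒m<1+n (ℕ.m<n⇒m<1+n bound)))
          (+-cong (*-congˡ (evaluate-trinomial m (1 ℕ.+ N) y (ℕ.m<n⇒m<1+n bound)))
                  (*-congˡ (evaluate-trinomial m N y bound))) ⟩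
    P + (y * P + (y * y) * P)
      ≈⟨ factor y P ⟩
    (1# + (y + y * y)) * P ∎
    where
    ι : ℕ → Carrier
    ι k = k × 1#
    t : ℕ → Carrier
    t k = trinomial m k × 1#
    p : Fin N → Carrier
    p k = y ^ toℕ k
    A B C : Fin N → Carrier
    A k = t (2 ℕ.+ toℕ k) * (y * (y * p k))
    B k = t (1 ℕ.+ toℕ k) * (y * p k)
    C k = t (toℕ k) * p k
    P : Carrier
    P = (1# + (y + y * y)) ^ m
    bound : m ℕ.+ m < N
    bound = ℕ.≤-pred (≡.subst (_< suc N) (ℕ.+-suc m m) (ℕ.≤-pred 2m<N))
    spread : ∀ a b c y p → (a + (b + c)) * (y * (y * p)) ≈
                           a * (y * (y * p)) + (y * (b * (y * p)) + (y * y) * (c * p))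
    spread = solve 5 (λ a b c y p → (a :+ (b :+ c)) :* (y :* (y :* p)) :=
                        a :* (y :* (y :* p)) :+ (y :* (b :* (y :* p)) :+ (y :* y) :* (c :* p))) refl
    regroup : ∀ t₀ t₁ y a b c →
      t₀ * 1# + ((t₁ + t₀) * (y * 1#) + (a + (y * b + (y * y) * c))) ≈
      (t₀ * 1# + (t₁ * (y * 1#) + a)) + (y * (t₀ * 1# + b) + (y * y) * c)
    regroup = solve 6 (λ t₀ t₁ y a b c →
      t₀ :* con 1 :+ ((t₁ :+ t₀) :* (y :* con 1) :+ (a :+ (y :* b :+ (y :* y) :* c))) :=
      (t₀ :* con 1 :+ (t₁ :* (y :* con 1) :+ a)) :+ (y :* (t₀ :* con 1 :+ b) :+ (y :* y) :* c)) refl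
    factor : ∀ y p → p + (y * p + (y * y) * p) ≈ (1# + (y + y * y)) * p
    factor = solve 2 (λ y p → p :+ (y :* p :+ (y :* y) :* p) := (con 1 :+ (y :+ y :* y)) :* p) refl

  -- Coefficients of a polynomial of degree < p + 6 reduced modulo X^(3 + p) - 1.
  wrap : ℕ → (ℕ → Carrier) → ℕ → Carrier
  wrap p f 0                   = f 0 + f (3 ℕ.+ p)
  wrap p f 1                   = f 1 + f (4 ℕ.+ p)
  wrap p f 2                   = f 2 + f (5 ℕ.+ p)
  wrap p f (suc (suc (suc k))) = f (3 ℕ.+ k)

  evaluate-wrap : ∀ p f y → y ^ (3 ℕ.+ p) ≈ 1# →
                  evaluate f (6 ℕ.+ p) y ≈ evaluate (wrap p f) (3 ℕ.+ p) y
  evaluate-wrap p f y yⁿ≈1 = begin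
    evaluate f (6 ℕ.+ p) y
      ≈⟨ trans (evaluate-last f (5 ℕ.+ p) y) (+-congʳ
           (trans (evaluate-last f (4 ℕ.+ p) y) (+-congʳ (evaluate-last f (3 ℕ.+ p) y)))) ⟩
    ((evaluate f (3 ℕ.+ p) y + f (3 ℕ.+ p) * yⁿ) + f (4 ℕ.+ p) * (y * yⁿ)) + f (5 ℕ.+ p) * (y * (y * yⁿ))
      ≈⟨ +-cong (+-cong (+-congˡ (*-congˡ yⁿ≈1)) (*-congˡ (*-congˡ yⁿ≈1))) (*-congˡ (*-congˡ (*-congˡ yⁿ≈1))) ⟩
    ((evaluate f (3 ℕ.+ p) y + f (3 ℕ.+ p) * 1#) + f (4 ℕ.+ p) * (y * 1#)) + f (5 ℕ.+ p) * (y * (y * 1#))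
      ≈⟨ collect (f 0) (f 1) (f 2) _ (f (3 ℕ.+ p)) (f (4 ℕ.+ p)) (f (5 ℕ.+ p)) (1#) (y * 1#) (y * (y * 1#)) ⟩
    evaluate (wrap p f) (3 ℕ.+ p) y ∎
    where
    yⁿ = y ^ (3 ℕ.+ p)
    collect : ∀ f₀ f₁ f₂ r g₀ g₁ g₂ y₀ y₁ y₂ →
      (((f₀ * y₀ + (f₁ * y₁ + (f₂ * y₂ + r))) + g₀ * y₀) + g₁ * y₁) + g₂ * y₂ ≈
      (f₀ + g₀) * y₀ + ((f₁ + g₁) * y₁ + ((f₂ + g₂) * y₂ + r))
    collect = solve 10 (λ f₀ f₁ f₂ r g₀ g₁ g₂ y₀ y₁ y₂ →
      (((f₀ :* y₀ :+ (f₁ :* y₁ :+ (f₂ :* y₂ :+ r))) :+ g₀ :* y₀) :+ g₁ :* y₁) :+ g₂ :* y₂ :=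
      (f₀ :+ g₀) :* y₀ :+ ((f₁ :+ g₁) :* y₁ :+ ((f₂ :+ g₂) :* y₂ :+ r))) refl

  -- The two outermost factors agree and form a square; removing them leaves a palindrome with the
  -- same centre. The number of factors is odd, so the central one stays unpaired.
  product-palindrome : ∀ r (g : ℕ → Carrier) → (∀ k l → k ℕ.+ l ≡ r ℕ.+ r → g k ≈ g l) →
    ∃ λ v → product {suc (r ℕ.+ r)} (λ k → g (toℕ k)) ≈ g r * (v * v)
  product-palindrome zero    g g-sym = 1# , *-congˡ (sym (*-identityˡ _))
  product-palindrome (suc r) g g-sym rewrite ℕ.+-suc r r =
    let v , eq = product-palindrome r (g ∘ suc) λ k l k+l≡2r →
                   g-sym (suc k) (suc l) (≡.cong suc (≡.trans (ℕ.+-suc k l) (≡.cong suc k+l≡2r)))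
    in g 0 * v , (begin
      g 0 * product {2 ℕ.+ (r ℕ.+ r)} (λ k → g (suc (toℕ k)))
        ≈⟨ *-congˡ (trans (Product.sum-init-last {suc (r ℕ.+ r)} (λ k → g (suc (toℕ k)))) (*-cong
             (trans (Product.sum-cong-≋ {suc (r ℕ.+ r)} λ k → reflexive (≡.cong (g ∘ suc) (Fin.toℕ-inject₁ k))) eq)
             (trans (reflexive (≡.cong (g ∘ suc) (Fin.toℕ-fromℕ (suc (r ℕ.+ r)))))
                    (g-sym (2 ℕ.+ (r ℕ.+ r)) 0 (ℕ.+-identityʳ _))))) ⟩
      g 0 * ((g (suc r) * (v * v)) * g 0) ≈⟨ rearrange (g 0) (g (suc r)) v ⟩
      g (suc r) * ((g 0 * v) * (g 0 * v)) ∎)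
    where
    rearrange : ∀ a b v → a * ((b * (v * v)) * a) ≈ b * ((a * v) * (a * v))
    rearrange = solve 3 (λ a b v → a :* ((b :* (v :* v)) :* a) := b :* ((a :* v) :* (a :* v))) refl

-- Finite fields

module FieldProperties {c ℓ q} (F : FiniteField c ℓ q) where
  open FiniteField F hiding (zero)
  open RawSemiringDefinitions (Semiring.rawSemiring semiring) using (product)
  open Determinant commutativeRing using (x+y≈0⇒x≈-y)
  open Exponentiation commutativeSemiring
  open RingProperties ring
  open SemiringSum semiring
  open SemiringMult semiring
  open SemiringSolver commutativeSemiring using (solve; _:+_; _:*_; _:=_; con)
  open SetoidReasoning setoid

  infix 4 _≟_
  _≟_ : ∀ x y → Dec (x ≈ y)
  _≟_ = _≈?_ F

  *-cancelˡ : ∀ {x y z} → ¬ (x ≈ 0#) → x * y ≈ x * z → y ≈ z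
  *-cancelˡ {x} {y} {z} x≉0 xy≈xz = begin
    y             ≈⟨ *-identityˡ y ⟨
    1# * y        ≈⟨ *-congʳ x⁻¹x≈1 ⟨
    (x⁻¹ * x) * y ≈⟨ *-assoc _ _ _ ⟩
    x⁻¹ * (x * y) ≈⟨ *-congˡ xy≈xz ⟩
    x⁻¹ * (x * z) ≈⟨ *-assoc _ _ _ ⟨
    (x⁻¹ * x) * z ≈⟨ *-congʳ x⁻¹x≈1 ⟩
    1# * z        ≈⟨ *-identityˡ z ⟩
    z             ∎
    where
    x⁻¹ = proj₁ (inverse x x≉0)
    x⁻¹x≈1 : x⁻¹ * x ≈ 1#
    x⁻¹x≈1 = trans (*-comm _ _) (proj₂ (inverse x x≉0))

  *-cancelʳ : ∀ {x y z} → ¬ (x ≈ 0#) → y * x ≈ z * x → y ≈ z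
  *-cancelʳ x≉0 yx≈zx = *-cancelˡ x≉0 (trans (*-comm _ _) (trans yx≈zx (*-comm _ _)))

  *-nonzero : ∀ {x y} → ¬ (x ≈ 0#) → ¬ (y ≈ 0#) → ¬ (x * y ≈ 0#)
  *-nonzero x≉0 y≉0 xy≈0 = y≉0 (*-cancelˡ x≉0 (trans xy≈0 (sym (zeroʳ _))))

  *-nonzeroʳ : ∀ {x y} → ¬ (x * y ≈ 0#) → ¬ (y ≈ 0#)
  *-nonzeroʳ xy≉0 y≈0 = xy≉0 (trans (*-congˡ y≈0) (zeroʳ _))

  product-nonzero : ∀ {n} (f : Fin n → Carrier) → (∀ i → ¬ (f i ≈ 0#)) → ¬ (product f ≈ 0#)
  product-nonzero {zero}  f f≉0 = 1≉0
  product-nonzero {suc n} f f≉0 = *-nonzero (f≉0 zero) (product-nonzero (f ∘ suc) (f≉0 ∘ suc))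

  1^ : ∀ k → 1# ^ k ≈ 1#
  1^ zero    = refl
  1^ (suc k) = trans (*-identityˡ _) (1^ k)

  square-roots : ∀ {x y} → x * x ≈ y * y → ¬ (x ≈ y) → x ≈ - y
  square-roots {x} {y} x²≈y² x≉y with (x + y) ≟ 0#
  ... | yes x+y≈0 = x+y≈0⇒x≈-y x+y≈0
  ... | no  x+y≉0 = contradiction (*-cancelʳ x+y≉0 (begin
    x * (x + y)   ≈⟨ distribˡ x x y ⟩
    x * x + x * y ≈⟨ +-cong x²≈y² (*-comm x y) ⟩
    y * y + y * x ≈⟨ +-comm _ _ ⟩
    y * x + y * y ≈⟨ distribˡ y x y ⟨
    y * (x + y)   ∎)) x≉y

  -- The value at x of the monic polynomial of degree k with the given lower coefficients.
  monic : ∀ {k} → Vec Carrier k → Carrier → Carrier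
  monic []       x = 1#
  monic (c ∷ cs) x = c + x * monic cs x

  -- Synthetic division by X - r: the coefficients are the Horner values at `r` of the tails of the
  -- dividend, the leading 1 again being implicit.
  quotient : ∀ {k} → Vec Carrier (suc k) → Carrier → Vec Carrier k
  quotient (c ∷ [])         r = []
  quotient (c ∷ cs@(_ ∷ _)) r = monic cs r ∷ quotient cs r

  -- p(x) - p(r) = (x - r) q(x), with both sides moved so that no subtraction occurs.
  monic-quotient : ∀ {k} (cs : Vec Carrier (suc k)) r x →
    monic cs x + r * monic (quotient cs r) x ≈ x * monic (quotient cs r) x + monic cs r
  monic-quotient (c ∷ []) r x =
    solve 3 (λ c r x → (c :+ x :* con 1) :+ r :* con 1 := x :* con 1 :+ (c :+ r :* con 1)) refl c r x
  monic-quotient (c ∷ cs@(_ ∷ _)) r x = begin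
    (c + x * p) + r * (pᵣ + x * p′) ≈⟨ regroupˡ c x p r pᵣ p′ ⟩
    (c + x * (p + r * p′)) + r * pᵣ ≈⟨ +-congʳ (+-congˡ (*-congˡ (monic-quotient cs r x))) ⟩
    (c + x * (x * p′ + pᵣ)) + r * pᵣ ≈⟨ regroupʳ c x r pᵣ p′ ⟩
    x * (pᵣ + x * p′) + (c + r * pᵣ) ∎
    where
    p  = monic cs x
    pᵣ = monic cs r
    p′ = monic (quotient cs r) x
    regroupˡ : ∀ c x p r pᵣ p′ → (c + x * p) + r * (pᵣ + x * p′) ≈ (c + x * (p + r * p′)) + r * pᵣ
    regroupˡ = solve 6 (λ c x p r pᵣ p′ →
      (c :+ x :* p) :+ r :* (pᵣ :+ x :* p′) := (c :+ x :* (p :+ r :* p′)) :+ r :* pᵣ) refl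
    regroupʳ : ∀ c x r pᵣ p′ → (c + x * (x * p′ + pᵣ)) + r * pᵣ ≈ x * (pᵣ + x * p′) + (c + r * pᵣ)
    regroupʳ = solve 5 (λ c x r pᵣ p′ →
      (c :+ x :* (x :* p′ :+ pᵣ)) :+ r :* pᵣ := x :* (pᵣ :+ x :* p′) :+ (c :+ r :* pᵣ)) refl

  -- Division by X - `b zero` lowers the degree. Every other `b (suc i)` is a root of the quotient,
  -- since otherwise the nonzero value of the quotient could be cancelled, giving
  -- `b zero ≈ b (suc i)`.
  monic-roots : ∀ {k m} (cs : Vec Carrier k) (b : Fin m → Carrier) →
    (∀ {i j} → b i ≈ b j → i ≡ j) → (∀ i → monic cs (b i) ≈ 0#) → m ≤ k
  monic-roots {zero}  {zero}  cs b b-injective roots = z≤n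
  monic-roots {suc k} {zero}  cs b b-injective roots = z≤n
  monic-roots {zero}  {suc m} [] b b-injective roots = contradiction (roots zero) 1≉0
  monic-roots {suc k} {suc m} cs b b-injective roots = s≤s (monic-roots (quotient cs r) (b ∘ suc)
    (Fin.suc-injective ∘ b-injective) quotient-root)
    where
    r = b zero
    quotient-root : ∀ i → monic (quotient cs r) (b (suc i)) ≈ 0#
    quotient-root i with monic (quotient cs r) (b (suc i)) ≟ 0#
    ... | yes root  = root
    ... | no  ¬root = contradiction (b-injective (*-cancelʳ ¬root (begin
      r * p′                      ≈⟨ +-identityˡ _ ⟨
      0# + r * p′                 ≈⟨ +-congʳ (roots (suc i)) ⟨
      monic cs x + r * p′         ≈⟨ monic-quotient cs r x ⟩
      x * p′ + monic cs r         ≈⟨ +-congˡ (roots zero) ⟩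
      x * p′ + 0#                 ≈⟨ +-identityʳ _ ⟩
      x * p′                      ∎))) λ ()
      where
      x  = b (suc i)
      p′ = monic (quotient cs r) x

  roots-of-unity : ∀ {k m} (b : Fin m → Carrier) →
    (∀ {i j} → b i ≈ b j → i ≡ j) → (∀ i → b i ^ suc k ≈ 1#) → m ≤ suc k
  roots-of-unity {k} b b-injective b^≈1 = monic-roots (- 1# ∷ Vec.replicate k 0#) b b-injective λ i → begin
    - 1# + b i * monic (Vec.replicate k 0#) (b i) ≈⟨ +-congˡ (*-congˡ (monic-0 k (b i))) ⟩
    - 1# + b i ^ suc k                            ≈⟨ +-congˡ (b^≈1 i) ⟩
    - 1# + 1#                                     ≈⟨ -‿inverseˡ 1# ⟩
    0#                                            ∎
    where
    monic-0 : ∀ k x → monic (Vec.replicate k 0#) x ≈ x ^ k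
    monic-0 zero    x = refl
    monic-0 (suc k) x = trans (+-identityˡ _) (*-congˡ (monic-0 k x))

  -- Translation by 1 permutes the field, so the sum of all elements equals itself plus q · 1.
  characteristic : q × 1# ≈ 0#
  characteristic = +-cancelˡ (sum to) _ _ (begin
    sum to + q × 1#            ≈⟨ +-congˡ (sum-replicate q) ⟨
    sum to + sum {q} (const 1#) ≈⟨ ∑-distrib-+ to (const 1#) ⟨
    sum (λ i → to i + 1#)      ≈⟨ sum-cong-≋ (λ i → strictlyInverseˡ (to i + 1#)) ⟨
    sum (to ∘ (shift 1#))      ≈⟨ sum-permute to π ⟨
    sum to                     ≈⟨ +-identityʳ _ ⟨
    sum to + 0#                ∎)
    where
    open Inverse enumeration using (to; from; from-cong; strictlyInverseˡ; strictlyInverseʳ)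
    shift : Carrier → Fin q → Fin q
    shift x i = from (to i + x)
    cancel : ∀ {x y} → x + y ≈ 0# → ∀ i → shift y (shift x i) ≡ i
    cancel {x} {y} x+y≈0 i = ≡.trans (from-cong (begin
      to (from (to i + x)) + y ≈⟨ +-congʳ (strictlyInverseˡ _) ⟩
      (to i + x) + y           ≈⟨ +-assoc _ _ _ ⟩
      to i + (x + y)           ≈⟨ +-congˡ x+y≈0 ⟩
      to i + 0#                ≈⟨ +-identityʳ _ ⟩
      to i                     ∎)) (strictlyInverseʳ i)
    π : Permutation′ q
    π = permutation (shift 1#) (shift (- 1#)) (cancel (-‿inverseˡ 1#)) (cancel (-‿inverseʳ 1#))

-- The multiplicative group, character sums and Euler's criterion

module NonzeroElements {c ℓ q} (F : FiniteField c ℓ q) {n} {a : Fin n → FiniteField.Carrier F}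
  (listing : ListsNonzeroElements F a) where
  open FiniteField F hiding (zero)
  open RawSemiringDefinitions (Semiring.rawSemiring semiring) using (product)
  open FieldProperties F
  open ListsNonzeroElements listing
  open Exponentiation commutativeSemiring
  open RingProperties ring using (-‿involutive)
  open SemiringSum semiring
  open SetoidReasoning setoid
  private module Product = CommutativeMonoidSum *-commutativeMonoid

  index : ∀ x → ¬ (x ≈ 0#) → Fin n
  index x x≉0 = proj₁ (complete x x≉0)

  a-index : ∀ x x≉0 → a (index x x≉0) ≈ x
  a-index x x≉0 = proj₂ (complete x x≉0)

  scale : ∀ g → ¬ (g ≈ 0#) → Fin n → Fin n
  scale g g≉0 i = index (g * a i) (*-nonzero g≉0 (nonzero i))

  a-scale : ∀ g g≉0 i → a (scale g g≉0 i) ≈ g * a i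
  a-scale g g≉0 i = a-index _ _

  scaling : ∀ g → ¬ (g ≈ 0#) → Permutation′ n
  scaling g g≉0 = permutation (scale g g≉0) (scale g⁻¹ g⁻¹≉0)
    (cancel g g≉0 g⁻¹ g⁻¹≉0 gg⁻¹≈1)
    (cancel g⁻¹ g⁻¹≉0 g g≉0 (trans (*-comm _ _) gg⁻¹≈1))
    where
    g⁻¹ = proj₁ (inverse g g≉0)
    gg⁻¹≈1 = proj₂ (inverse g g≉0)
    g⁻¹≉0 : ¬ (g⁻¹ ≈ 0#)
    g⁻¹≉0 = *-nonzeroʳ λ gg⁻¹≈0 → 1≉0 (trans (sym gg⁻¹≈1) gg⁻¹≈0)
    cancel : ∀ x x≉0 y y≉0 → x * y ≈ 1# → ∀ i → scale x x≉0 (scale y y≉0 i) ≡ i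
    cancel x x≉0 y y≉0 xy≈1 i = injective (begin
      a (scale x x≉0 (scale y y≉0 i)) ≈⟨ a-scale x x≉0 _ ⟩
      x * a (scale y y≉0 i)           ≈⟨ *-congˡ (a-scale y y≉0 i) ⟩
      x * (y * a i)                   ≈⟨ *-assoc _ _ _ ⟨
      (x * y) * a i                   ≈⟨ *-congʳ xy≈1 ⟩
      1# * a i                        ≈⟨ *-identityˡ _ ⟩
      a i                             ∎)

  -- Multiplication by `x` permutes the nonzero elements, so their product equals itself times
  -- `x ^ n`.
  fermat : ∀ x → ¬ (x ≈ 0#) → x ^ n ≈ 1#
  fermat x x≉0 = *-cancelʳ (product-nonzero a nonzero) (begin
    x ^ n * product a                        ≈⟨ *-congʳ (Product.sum-replicate n) ⟨
    product {n} (const x) * product a        ≈⟨ Product.∑-distrib-+ (const x) a ⟨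
    product (λ i → x * a i)                  ≈⟨ Product.sum-cong-≋ (a-scale x x≉0) ⟨
    product (a ∘ scale x x≉0)                ≈⟨ Product.sum-permute a (scaling x x≉0) ⟨
    product a                                ≈⟨ *-identityˡ _ ⟨
    1# * product a                           ∎)

  -- Otherwise a polynomial of degree `suc k` would have `n` distinct roots. This takes the place of
  -- a generator of the multiplicative group.
  power≉1 : ∀ {k} → suc k < n → ∃ λ i → ¬ (a i ^ suc k ≈ 1#)
  power≉1 {k} k<n = Fin.¬∀⟶∃¬ n _ (λ i → (a i ^ suc k) ≟ 1#)
    λ all → ℕ.<⇒≱ k<n (roots-of-unity a injective all)

  -- Reindexing by multiplication with an element `g` such that `φ g` is not 1 multiplies the sum by
  -- `φ g` without changing it.
  character-sum : (φ : Carrier → Carrier) → (∀ {x y} → x ≈ y → φ x ≈ φ y) →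
    (∀ x y → φ (x * y) ≈ φ x * φ y) → (∃ λ i → ¬ (φ (a i) ≈ 1#)) → sum (φ ∘ a) ≈ 0#
  character-sum φ φ-cong φ-homo (i , φg≉1) with sum (φ ∘ a) ≟ 0#
  ... | yes Σ≈0 = Σ≈0
  ... | no  Σ≉0 = contradiction (*-cancelʳ Σ≉0 (begin
    φ g * sum (φ ∘ a)             ≈⟨ *-distribˡ-sum (φ g) (φ ∘ a) ⟩
    sum (λ j → φ g * φ (a j))     ≈⟨ sum-cong-≋ (λ j → trans (φ-cong (a-scale g (nonzero i) j)) (φ-homo g (a j))) ⟨
    sum (φ ∘ a ∘ scale g (nonzero i)) ≈⟨ sum-permute (φ ∘ a) (scaling g (nonzero i)) ⟨
    sum (φ ∘ a)                   ≈⟨ *-identityˡ _ ⟨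
    1# * sum (φ ∘ a)              ∎)) φg≉1
    where g = a i

  module Euler {h} (n≡2h : n ≡ suc h ℕ.+ suc h) where

    ^n : ∀ x → x ^ n ≈ (x * x) ^ suc h
    ^n x = begin
      x ^ n                   ≈⟨ ^-congʳ x n≡2h ⟩
      x ^ (suc h ℕ.+ suc h)   ≈⟨ ^-homo-* x (suc h) (suc h) ⟩
      x ^ suc h * x ^ suc h   ≈⟨ ^-distrib-* x x (suc h) ⟨
      (x * x) ^ suc h         ∎

    square-power : ∀ {x} → ¬ (x ≈ 0#) → (x * x) ^ suc h ≈ 1#
    square-power {x} x≉0 = trans (sym (^n x)) (fermat x x≉0)

    negation-index : Fin n → Fin n
    negation-index i = index (- a i) λ -a≈0 → nonzero i
      (trans (sym (-‿involutive _)) (trans (-‿cong -a≈0) (trans (sym (+-identityˡ _)) (-‿inverseʳ _))))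

    a-negation-index : ∀ i → a (negation-index i) ≈ - a i
    a-negation-index i = a-index _ _

    -- Otherwise the squares of a half-system together with Q times the squares of its
    -- complement would be n distinct roots of X ^ (n / 2) - 1.
    nonsquare-power : ∀ {Q} → ¬ (Q ≈ 0#) → ¬ IsSquare F Q → ¬ (Q ^ suc h ≈ 1#)
    nonsquare-power {Q} Q≉0 nonsquare Q^≈1 =
      ℕ.<⇒≱ (≡.subst (suc h <_) (≡.sym n≡2h) (ℕ.m<m+n (suc h) (s≤s z≤n)))
        (roots-of-unity root (λ {i} {j} → root-injective i j) root-power)
      where
      -- The half-system takes from each pair of opposite elements the one with the smaller index.
      half? : ∀ i → Dec (toℕ i < toℕ (negation-index i))
      half? i = toℕ i ℕ.<? toℕ (negation-index i)

      root′ : ∀ i → Dec (toℕ i < toℕ (negation-index i)) → Carrier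
      root′ i (yes _) = a i * a i
      root′ i (no  _) = Q * (a i * a i)

      root : Fin n → Carrier
      root i = root′ i (half? i)

      root-power′ : ∀ i d → root′ i d ^ suc h ≈ 1#
      root-power′ i (yes _) = square-power (nonzero i)
      root-power′ i (no  _) = begin
        (Q * (a i * a i)) ^ suc h         ≈⟨ ^-distrib-* Q (a i * a i) (suc h) ⟩
        Q ^ suc h * (a i * a i) ^ suc h   ≈⟨ *-cong Q^≈1 (square-power (nonzero i)) ⟩
        1# * 1#                           ≈⟨ *-identityˡ _ ⟩
        1#                                ∎

      root-power : ∀ i → root i ^ suc h ≈ 1#
      root-power i = root-power′ i (half? i)

      negated : ∀ i j → a i ≈ - a j → negation-index j ≡ i
      negated i j eq = injective (trans (a-negation-index j) (sym eq))

      negated′ : ∀ i j → a i ≈ - a j → negation-index i ≡ j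
      negated′ i j eq = injective (trans (a-negation-index i) (trans (-‿cong eq) (-‿involutive _)))

      mixed : ∀ i j → ¬ (a i * a i ≈ Q * (a j * a j))
      mixed i j eq = nonsquare (a i * b , (begin
        (a i * b) * (a i * b)       ≈⟨ interchange (a i) b ⟩
        (a i * a i) * (b * b)       ≈⟨ *-congʳ eq ⟩
        (Q * (a j * a j)) * (b * b) ≈⟨ regroup Q (a j) b ⟩
        Q * ((a j * b) * (a j * b)) ≈⟨ *-congˡ (*-cong ab≈1 ab≈1) ⟩
        Q * (1# * 1#)               ≈⟨ trans (*-congˡ (*-identityˡ _)) (*-identityʳ _) ⟩
        Q                           ∎))
        where
        open SemiringSolver commutativeSemiring using (solve; _:*_; _:=_)
        b = proj₁ (inverse (a j) (nonzero j))
        ab≈1 = proj₂ (inverse (a j) (nonzero j))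
        interchange : ∀ x y → (x * y) * (x * y) ≈ (x * x) * (y * y)
        interchange = solve 2 (λ x y → (x :* y) :* (x :* y) := (x :* x) :* (y :* y)) refl
        regroup : ∀ q x y → (q * (x * x)) * (y * y) ≈ q * ((x * y) * (x * y))
        regroup = solve 3 (λ q x y → (q :* (x :* x)) :* (y :* y) := q :* ((x :* y) :* (x :* y))) refl

      same-square : ∀ i j → a i * a i ≈ a j * a j →
                    (toℕ (negation-index i) ≡ toℕ j → toℕ (negation-index j) ≡ toℕ i → i ≡ j) → i ≡ j
      same-square i j eq distinct with i Fin.≟ j
      ... | yes i≡j = i≡j
      ... | no  i≢j = distinct (≡.cong toℕ (negated′ i j ai≈-aj)) (≡.cong toℕ (negated i j ai≈-aj))
        where ai≈-aj = square-roots eq (i≢j ∘ injective)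

      root-injective′ : ∀ i j d e → root′ i d ≈ root′ j e → i ≡ j
      -- If `a i` and `a j` are opposite, two answers `yes` would make each index smaller than the
      -- other, and two answers `no` bound each index by the other, so that they coincide.
      root-injective′ i j (yes i<i′) (yes j<j′) eq = same-square i j eq λ i′≡j j′≡i →
        contradiction (≡.subst (_ <_) j′≡i j<j′) (ℕ.<⇒≯ (≡.subst (_ <_) i′≡j i<i′))
      root-injective′ i j (no i≮i′) (no j≮j′) eq =
        same-square i j (*-cancelˡ Q≉0 eq) λ i′≡j j′≡i →
          Fin.toℕ-injective (ℕ.≤-antisym (≡.subst (_≤ _) j′≡i (ℕ.≮⇒≥ j≮j′)) (≡.subst (_≤ _) i′≡j (ℕ.≮⇒≥ i≮i′)))
      root-injective′ i j (yes _) (no  _) eq = contradiction eq (mixed i j)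
      root-injective′ i j (no  _) (yes _) eq = contradiction (sym eq) (mixed j i)

      root-injective : ∀ i j → root i ≈ root j → i ≡ j
      root-injective i j = root-injective′ i j (half? i) (half? j)

    -- The additional factor `x` makes both sides vanish at 0, so the power formula holds without
    -- exception; it also raises the exponent from n/2 to n/2 + 1 = (q + 1)/2.
    euler : ∀ x → x * χ F x ≈ x ^ suc (suc h)
    euler x = by-cases (x ≟ 0#) (isSquare? F x)
      where
      by-cases : (d : Dec (x ≈ 0#)) (e : Dec (IsSquare F x)) →
        x * (if does d then 0# else if does e then 1# else - 1#) ≈ x ^ suc (suc h)
      by-cases (yes x≈0) _ = trans (zeroʳ x) (sym (trans (*-congʳ x≈0) (zeroˡ _)))
      by-cases (no x≉0) (yes (y , y²≈x)) = *-congˡ (begin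
        1#               ≈⟨ square-power (λ y≈0 → x≉0 (trans (sym y²≈x) (trans (*-congʳ y≈0) (zeroˡ y)))) ⟨
        (y * y) ^ suc h  ≈⟨ ^-congˡ (suc h) y²≈x ⟩
        x ^ suc h        ∎)
      by-cases (no x≉0) (no nonsquare) = *-congˡ (sym (square-roots (begin
        x ^ suc h * x ^ suc h ≈⟨ ^-homo-* x (suc h) (suc h) ⟨
        x ^ (suc h ℕ.+ suc h) ≈⟨ ^-congʳ x n≡2h ⟨
        x ^ n                 ≈⟨ fermat x x≉0 ⟩
        1#                    ≈⟨ *-identityˡ 1# ⟨
        1# * 1#               ∎) (nonsquare-power x≉0 nonsquare)))

-- The factorisation of S

-- With the order written as 5 + 2r, the three wrapped positions and the 2r + 1 positions after them
-- are visible to computation, and m = 3 + r is the centre of the latter.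
module Factorisation {c ℓ} r (F : FiniteField c ℓ (5 ℕ.+ (r ℕ.+ r)))
  {a : Fin (4 ℕ.+ (r ℕ.+ r)) → FiniteField.Carrier F} (listing : ListsNonzeroElements F a) where
  open FiniteField F hiding (zero)
  open RawSemiringDefinitions (Semiring.rawSemiring semiring) using (product)
  open FieldProperties F
  open NonzeroElements F listing
  open ListsNonzeroElements listing
  open Determinant commutativeRing
  open TrinomialExpansion commutativeRing
  open Exponentiation commutativeSemiring
  open RingProperties ring
  open SemiringSum semiring
  open SemiringMult semiring
  open SemiringSolver commutativeSemiring using (solve; _:+_; _:*_; _:=_; con)
  open SetoidReasoning setoid
  private module Product = CommutativeMonoidSum *-commutativeMonoid

  n n-1 m : ℕ
  n-1 = 3 ℕ.+ (r ℕ.+ r)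
  n   = suc n-1
  m   = 3 ℕ.+ r

  n≡2h : n ≡ (2 ℕ.+ r) ℕ.+ (2 ℕ.+ r)
  n≡2h = ≡.sym (≡.cong (2 ℕ.+_) (≡.trans (ℕ.+-suc r (suc r)) (≡.cong suc (ℕ.+-suc r r))))

  m+m≡6+2r : m ℕ.+ m ≡ 6 ℕ.+ (r ℕ.+ r)
  m+m≡6+2r = ≡.cong (3 ℕ.+_) (≡.trans (ℕ.+-suc r (2 ℕ.+ r))
    (≡.cong suc (≡.trans (ℕ.+-suc r (suc r)) (≡.cong suc (ℕ.+-suc r r)))))

  open Euler {suc r} n≡2h

  -- The inverse of `a j`, by Fermat. Its form as a power makes it multiplicative in `a j`, on which
  -- `φ-homo` relies.
  b : Fin n → Carrier
  b j = a j ^ n-1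

  ab≈1 : ∀ j → a j * b j ≈ 1#
  ab≈1 j = fermat (a j) (nonzero j)

  t : ℕ → Carrier
  t k = trinomial m k × 1#

  t-sym : ∀ k l → k ℕ.+ l ≡ 6 ℕ.+ (r ℕ.+ r) → t k ≈ t l
  t-sym k l k+l≡2m = reflexive (≡.cong (_× 1#) (trinomial-sym m k l (≡.trans k+l≡2m (≡.sym m+m≡6+2r))))

  d : ℕ → Carrier
  d = wrap (suc (r ℕ.+ r)) t

  V D W E : Matrix n n
  V i l = a i ^ toℕ l
  D     = diagonal (d ∘ toℕ)
  W l j = b j ^ toℕ l
  E     = diagonal λ j → a j * a j

  S-entry : ∀ i j → S F a i j ≈ (a j * a j) * evaluate d n (a i * b j)
  S-entry i j = begin
    Q * χ F Q                                 ≈⟨ euler Q ⟩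
    Q ^ m                                     ≈⟨ ^-congˡ m Q≈ ⟩
    ((a j * a j) * (1# + (y + y * y))) ^ m    ≈⟨ ^-distrib-* (a j * a j) (1# + (y + y * y)) m ⟩
    -- Since m = n/2 + 1, the power of aⱼ² reduces to aⱼ² itself. The length 7 + 2r is 2m + 1, just
    -- enough for all coefficients of f.
    (a j * a j) ^ m * (1# + (y + y * y)) ^ m  ≈⟨ *-cong
                                                   (trans (*-congˡ (square-power (nonzero j))) (*-identityʳ _))
                                                   (sym (evaluate-trinomial m (7 ℕ.+ (r ℕ.+ r)) y
                                                      (ℕ.≤-reflexive (≡.cong suc m+m≡6+2r)))) ⟩
    (a j * a j) * evaluate t (7 ℕ.+ (r ℕ.+ r)) y
                                              ≈⟨ *-congˡ (evaluate-wrap (suc (r ℕ.+ r)) t y (fermat y y≉0)) ⟩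
    (a j * a j) * evaluate d n y              ∎
    where
    Q y : Carrier
    Q = a i * a i + a i * a j + a j * a j
    y = a i * b j
    y≉0 : ¬ (y ≈ 0#)
    y≉0 = *-nonzero (nonzero i) (*-nonzeroʳ λ ab≈0 → 1≉0 (trans (sym (ab≈1 j)) ab≈0))
    Q≈ : Q ≈ (a j * a j) * (1# + (y + y * y))
    Q≈ = begin
      a i * a i + a i * a j + a j * a j
        ≈⟨ homogenise (a i) (a j) ⟩
      -- Factors 1 are inserted so that, once each is replaced by `a j * b j`, every term contains
      -- aⱼ².
      (a j * a j) * 1# + ((a i * a j) * 1# + (a i * a i) * (1# * 1#))
        ≈⟨ +-congˡ (+-cong (*-congˡ (ab≈1 j)) (*-congˡ (*-cong (ab≈1 j) (ab≈1 j)))) ⟨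
      (a j * a j) * 1# + ((a i * a j) * (a j * b j) + (a i * a i) * ((a j * b j) * (a j * b j)))
        ≈⟨ factor (a i) (a j) (b j) ⟩
      (a j * a j) * (1# + (y + y * y)) ∎
      where
      homogenise : ∀ x z → x * x + x * z + z * z ≈ (z * z) * 1# + ((x * z) * 1# + (x * x) * (1# * 1#))
      homogenise = solve 2 (λ x z → x :* x :+ x :* z :+ z :* z :=
        (z :* z) :* con 1 :+ ((x :* z) :* con 1 :+ (x :* x) :* (con 1 :* con 1))) refl
      factor : ∀ x z w → (z * z) * 1# + ((x * z) * (z * w) + (x * x) * ((z * w) * (z * w))) ≈
                         (z * z) * (1# + (x * w + (x * w) * (x * w)))
      factor = solve 3 (λ x z w →
        (z :* z) :* con 1 :+ ((x :* z) :* (z :* w) :+ (x :* x) :* ((z :* w) :* (z :* w))) :=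
        (z :* z) :* (con 1 :+ (x :* w :+ (x :* w) :* (x :* w)))) refl

  S≈VDWE : ∀ i j → S F a i j ≈ (V ⊗ D ⊗ W ⊗ E) i j
  S≈VDWE i j = begin
    S F a i j                                ≈⟨ S-entry i j ⟩
    (a j * a j) * evaluate d n (a i * b j)   ≈⟨ *-comm _ _ ⟩
    evaluate d n (a i * b j) * (a j * a j)   ≈⟨ *-congʳ (sum-cong-≋ {n} λ l → begin
      d (toℕ l) * (a i * b j) ^ toℕ l            ≈⟨ *-congˡ (^-distrib-* (a i) (b j) (toℕ l)) ⟩
      d (toℕ l) * (V i l * W l j)                ≈⟨ *-assoc _ _ _ ⟨
      (d (toℕ l) * V i l) * W l j                ≈⟨ *-congʳ (*-comm _ _) ⟩
      (V i l * d (toℕ l)) * W l j                ≈⟨ *-congʳ (⊗-diagonal V (d ∘ toℕ) i l) ⟨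
      (V ⊗ D) i l * W l j                        ∎) ⟩
    (V ⊗ D ⊗ W) i j * (a j * a j)            ≈⟨ ⊗-diagonal (V ⊗ D ⊗ W) (λ j → a j * a j) i j ⟨
    (V ⊗ D ⊗ W ⊗ E) i j                      ∎

  n×1≈-1 : n × 1# ≈ - 1#
  n×1≈-1 = x+y≈0⇒x≈-y (trans (+-comm _ _) characteristic)

  -- x ↦ x⁻ˡ xᵏ
  φ : ℕ → ℕ → Carrier → Carrier
  φ l k x = (x ^ n-1) ^ l * x ^ k

  φ-cong : ∀ l k {x y} → x ≈ y → φ l k x ≈ φ l k y
  φ-cong l k x≈y = *-cong (^-congˡ l (^-congˡ n-1 x≈y)) (^-congˡ k x≈y)

  φ-homo : ∀ l k x y → φ l k (x * y) ≈ φ l k x * φ l k y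
  φ-homo l k x y = begin
    ((x * y) ^ n-1) ^ l * (x * y) ^ k
      ≈⟨ *-cong (trans (^-congˡ l (^-distrib-* x y n-1)) (^-distrib-* _ _ l)) (^-distrib-* x y k) ⟩
    ((x ^ n-1) ^ l * (y ^ n-1) ^ l) * (x ^ k * y ^ k)
      ≈⟨ interchange _ _ _ _ ⟩
    φ l k x * φ l k y ∎
    where
    interchange : ∀ p q s u → (p * q) * (s * u) ≈ (p * s) * (q * u)
    interchange = solve 4 (λ p q s u → (p :* q) :* (s :* u) := (p :* s) :* (q :* u)) refl

  φ-diagonal : ∀ l j → φ l l (a j) ≈ 1#
  φ-diagonal l j = begin
    b j ^ l * a j ^ l ≈⟨ ^-distrib-* (b j) (a j) l ⟨
    (b j * a j) ^ l   ≈⟨ ^-congˡ l (trans (*-comm _ _) (ab≈1 j)) ⟩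
    1# ^ l            ≈⟨ 1^ l ⟩
    1#                ∎

  -- On nonzero elements `φ l k` is the power with exponent k - l, or the inverse of the power with
  -- exponent l - k. The difference `suc e` lies strictly between 0 and `n`, so `power≉1` provides
  -- an element at which it is not 1.
  φ-nontrivial : ∀ {l k} → l < n → k < n → l ≢ k → ∃ λ i → ¬ (φ l k (a i) ≈ 1#)
  φ-nontrivial {l} {k} l<n k<n l≢k with ℕ.<-cmp l k
  ... | tri≈ _ l≡k _ = contradiction l≡k l≢k
  ... | tri< l<k _ _ with e , ≡.refl ← ℕ.m≤n⇒∃[o]m+o≡n l<k =
    let i , aᵢ^≉1 = power≉1 {e} (ℕ.≤-<-trans (ℕ.≤-trans (ℕ.m≤n+m (suc e) l) (ℕ.≤-reflexive (ℕ.+-suc l e))) k<n)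
    in i , λ φ≈1 → aᵢ^≉1 (begin
      a i ^ suc e                       ≈⟨ *-identityˡ _ ⟨
      1# * a i ^ suc e                  ≈⟨ *-congʳ (φ-diagonal l i) ⟨
      φ l l (a i) * a i ^ suc e         ≈⟨ *-assoc _ _ _ ⟩
      b i ^ l * (a i ^ l * a i ^ suc e) ≈⟨ *-congˡ (^-homo-* (a i) l (suc e)) ⟨
      b i ^ l * a i ^ (l ℕ.+ suc e)     ≈⟨ *-congˡ (^-congʳ (a i) (ℕ.+-suc l e)) ⟩
      φ l k (a i)                       ≈⟨ φ≈1 ⟩
      1#                                ∎)
  φ-nontrivial {l} {k} l<n k<n l≢k | tri> _ _ k<l with e , ≡.refl ← ℕ.m≤n⇒∃[o]m+o≡n k<l =
    let i , aᵢ^≉1 = power≉1 {e} (ℕ.≤-<-trans (ℕ.≤-trans (ℕ.m≤n+m (suc e) k) (ℕ.≤-reflexive (ℕ.+-suc k e))) l<n)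
    in i , λ φ≈1 → aᵢ^≉1 (begin
      a i ^ suc e                       ≈⟨ *-identityˡ _ ⟨
      1# * a i ^ suc e                  ≈⟨ *-congʳ φ≈1 ⟨
      φ l k (a i) * a i ^ suc e         ≈⟨ *-assoc _ _ _ ⟩
      b i ^ l * (a i ^ k * a i ^ suc e) ≈⟨ *-congˡ (^-homo-* (a i) k (suc e)) ⟨
      b i ^ l * a i ^ (k ℕ.+ suc e)     ≈⟨ *-congˡ (^-congʳ (a i) (ℕ.+-suc k e)) ⟩
      φ l l (a i)                       ≈⟨ φ-diagonal l i ⟩
      1#                                ∎)

  WV≈-1 : ∀ l k → (W ⊗ V) l k ≈ diagonal (const (- 1#)) l k
  WV≈-1 l k with l Fin.≟ k
  ... | yes ≡.refl = begin
    sum (λ j → φ (toℕ l) (toℕ l) (a j)) ≈⟨ sum-cong-≋ (φ-diagonal (toℕ l)) ⟩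
    sum {n} (const 1#)                  ≈⟨ sum-replicate n ⟩
    n × 1#                              ≈⟨ n×1≈-1 ⟩
    - 1#                                ≈⟨ *-identityʳ _ ⟨
    - 1# * 1#                           ≈⟨ *-congˡ (δ-diagonal l) ⟨
    - 1# * δ l l                        ∎
  ... | no l≢k = begin
    sum (λ j → φ (toℕ l) (toℕ k) (a j)) ≈⟨ character-sum (φ (toℕ l) (toℕ k))
                                             (φ-cong (toℕ l) (toℕ k)) (φ-homo (toℕ l) (toℕ k))
                                             (φ-nontrivial (Fin.toℕ<n l) (Fin.toℕ<n k) (l≢k ∘ Fin.toℕ-injective)) ⟩
    0#                                  ≈⟨ zeroʳ _ ⟨
    - 1# * 0#                           ≈⟨ *-congˡ (δ-off-diagonal l≢k) ⟨
    - 1# * δ l k                        ∎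

  detW*detV≈1 : det W * det V ≈ 1#
  detW*detV≈1 = begin
    det W * det V                         ≈⟨ det-⊗ {n} W V ⟨
    det (W ⊗ V)                           ≈⟨ det-cong {n} {W ⊗ V} {diagonal (const (- 1#))} WV≈-1 ⟩
    det {n} (diagonal (const (- 1#)))     ≈⟨ det-diagonal {n} (const (- 1#)) ⟩
    product {n} (const (- 1#))            ≈⟨ Product.sum-replicate n ⟩
    -- Fermat's theorem at -1 yields the sign, so the parity of `n` need not be invoked here.
    (- 1#) ^ n                            ≈⟨ fermat (- 1#) (λ -1≈0 → 1≉0
                                               (trans (sym (-‿involutive 1#)) (trans (-‿cong -1≈0) -0#≈0#))) ⟩
    1#                                    ∎

  d₁≈1 : d 1 ≈ 1#
  d₁≈1 = begin
    t 1 + t (5 ℕ.+ (r ℕ.+ r)) ≈⟨ +-congˡ (t-sym 1 (5 ℕ.+ (r ℕ.+ r)) ≡.refl) ⟨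
    t 1 + t 1                 ≈⟨ ×-homo-+ 1# (trinomial m 1) (trinomial m 1) ⟨
    (trinomial m 1 ℕ.+ trinomial m 1) × 1#
                              ≈⟨ ×-congˡ (≡.trans (≡.cong₂ ℕ._+_ (trinomial-1 m) (trinomial-1 m)) m+m≡6+2r) ⟩
    1# + (5 ℕ.+ (r ℕ.+ r)) × 1# ≈⟨ +-congˡ characteristic ⟩
    1# + 0#                   ≈⟨ +-identityʳ _ ⟩
    1#                        ∎

  -- Here d₀ = t₀ + tₙ and d₂ = t₂ + tₙ₊₂; the reflection of k to n + 2 - k interchanges the two
  -- sums.
  d₂≈d₀ : d 2 ≈ d 0
  d₂≈d₀ = trans (+-comm _ _)
    (+-cong (sym (t-sym 0 (6 ℕ.+ (r ℕ.+ r)) ≡.refl)) (t-sym 2 (4 ℕ.+ (r ℕ.+ r)) ≡.refl))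

  product-d : ∃ λ v → product {n} (d ∘ toℕ) ≈ t m * (v * v)
  product-d =
    -- The indices from 3 to n - 1 are untouched by wrapping. Shifted down by 3 they run from 0 to
    -- 2r, and their centre `r` corresponds to `m`.
    let v , eq = product-palindrome r (t ∘ (3 ℕ.+_)) λ k l k+l≡2r → t-sym (3 ℕ.+ k) (3 ℕ.+ l)
                   (≡.trans (shift k l) (≡.cong (6 ℕ.+_) k+l≡2r))
    in d 0 * v , (begin
      d 0 * (d 1 * (d 2 * product {suc (r ℕ.+ r)} (λ k → t (3 ℕ.+ toℕ k))))
        ≈⟨ *-congˡ (*-cong d₁≈1 (*-cong d₂≈d₀ eq)) ⟩
      d 0 * (1# * (d 0 * (t m * (v * v)))) ≈⟨ rearrange (d 0) (t m) v ⟩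
      t m * ((d 0 * v) * (d 0 * v)) ∎)
    where
    shift : ∀ k l → (3 ℕ.+ k) ℕ.+ (3 ℕ.+ l) ≡ 6 ℕ.+ (k ℕ.+ l)
    shift = solve-∀
    rearrange : ∀ x y v → x * (1# * (x * (y * (v * v)))) ≈ y * ((x * v) * (x * v))
    rearrange = solve 3 (λ x y v → x :* (con 1 :* (x :* (y :* (v :* v)))) := y :* ((x :* v) :* (x :* v))) refl

  det-S : ∃ λ u → det (S F a) ≈ t m * (u * u)
  det-S = let v , eq = product-d in v * product a , (begin
    det (S F a)                                   ≈⟨ det-cong {n} {S F a} {V ⊗ D ⊗ W ⊗ E} S≈VDWE ⟩
    det (V ⊗ D ⊗ W ⊗ E)                           ≈⟨ det-⊗ {n} (V ⊗ D ⊗ W) E ⟩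
    det (V ⊗ D ⊗ W) * det E                       ≈⟨ *-congʳ (trans (det-⊗ {n} (V ⊗ D) W) (*-congʳ (det-⊗ {n} V D))) ⟩
    ((det V * det D) * det W) * det E             ≈⟨ *-cong (*-congʳ (*-congˡ (trans (det-diagonal {n} (d ∘ toℕ)) eq)))
                                                       (trans (det-diagonal {n} (λ j → a j * a j)) (Product.∑-distrib-+ a a)) ⟩
    ((det V * (t m * (v * v))) * det W) * (product a * product a)
                                                  ≈⟨ rearrange (det V) (det W) (t m) v (product a) ⟩
    (det W * det V) * (t m * ((v * product a) * (v * product a)))
                                                  ≈⟨ trans (*-congʳ detW*detV≈1) (*-identityˡ _) ⟩
    t m * ((v * product a) * (v * product a))     ∎)
    where
    rearrange : ∀ x w y v p → ((x * (y * (v * v))) * w) * (p * p) ≈ (w * x) * (y * ((v * p) * (v * p)))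
    rearrange = solve 5 (λ x w y v p →
      ((x :* (y :* (v :* v))) :* w) :* (p :* p) := (w :* x) :* (y :* ((v :* p) :* (v :* p)))) refl

-- Reduction to orders of the form 5 + 2r

parity : ∀ n → (∃ λ k → n ≡ k ℕ.+ k) ⊎ (∃ λ k → n ≡ suc (k ℕ.+ k))
parity zero = inj₁ (0 , ≡.refl)
parity (suc n) with parity n
... | inj₁ (k , ≡.refl) = inj₂ (k , ≡.refl)
... | inj₂ (k , ≡.refl) = inj₁ (suc k , ≡.cong suc (≡.sym (ℕ.+-suc k k)))

order≢1 : ∀ {c ℓ q} → FiniteField c ℓ q → q ≢ 1
order≢1 F ≡.refl = 1≉0 (trans (sym (strictlyInverseˡ 1#)) (trans (single (from 1#) (from 0#)) (strictlyInverseˡ 0#)))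
  where
  open FiniteField F hiding (zero)
  open Inverse enumeration using (to; from; strictlyInverseˡ)
  single : ∀ i j → to i ≈ to j
  single zero zero = refl

odd-order : ∀ {c ℓ q} → FiniteField c ℓ q → ¬ (2 ∣ q) → q ≢ 3 → ∃ λ r → q ≡ 5 ℕ.+ (r ℕ.+ r)
odd-order {q = q} F odd q≢3 with parity q
... | inj₁ (k , q≡2k)                     = contradiction (divides k (≡.trans q≡2k (double k))) odd
  where
  double : ∀ k → k ℕ.+ k ≡ k ℕ.* 2
  double = solve-∀
... | inj₂ (zero , q≡1)                   = contradiction q≡1 (order≢1 F)
... | inj₂ (suc zero , q≡3)               = contradiction q≡3 q≢3
... | inj₂ (suc (suc r) , q≡5+2r)         = r , ≡.trans q≡5+2r (shift r)
  where
  shift : ∀ r → suc ((2 ℕ.+ r) ℕ.+ (2 ℕ.+ r)) ≡ 5 ℕ.+ (r ℕ.+ r)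
  shift = solve-∀

half-order : ∀ r → (5 ℕ.+ (r ℕ.+ r) ℕ.+ 1) / 2 ≡ 3 ℕ.+ r
half-order r = ≡.trans (≡.cong (_/ 2) (double r)) (m*n/n≡m (3 ℕ.+ r) 2)
  where
  double : ∀ r → 5 ℕ.+ (r ℕ.+ r) ℕ.+ 1 ≡ (3 ℕ.+ r) ℕ.* 2
  double = solve-∀

-- The order is still a variable here, so matching on the equation rewrites the types of the field
-- and of the listing. `fromℤ` of a nonnegative integer is by computation the multiple of 1 used in
-- `det-S`, which leaves only an equation between integers.
det-S-order : ∀ {c ℓ q} → (∃ λ r → q ≡ 5 ℕ.+ (r ℕ.+ r)) →
  (F : FiniteField c ℓ q) → let open FiniteField F in
  {a : Fin (q ∸ 1) → Carrier} → ListsNonzeroElements F a →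
  ∃ λ u → determinant commutativeRing (S F a) ≈
            fromℤ commutativeRing (centralTrinomial ((q ℕ.+ 1) / 2)) * (u * u)
det-S-order (r , ≡.refl) F listing =
  let u , det-S≈ = Factorisation.det-S r F listing
  in u , trans det-S≈ (*-congʳ (reflexive (≡.cong (fromℤ commutativeRing) (≡.sym
           (≡.trans (≡.cong centralTrinomial (half-order r)) (centralTrinomial-trinomial (3 ℕ.+ r)))))))
  where open FiniteField F

theorem1p1 : ∀ {c ℓ} (q : ℕ) → IsOddPrimePower q → q ≢ 3 →
    (F : FiniteField c ℓ q) → let open FiniteField F in
    (a : Fin (q ∸ 1) → Carrier) → ListsNonzeroElements F a →
    ∃ λ u → determinant commutativeRing (S F a) ≈ fromℤ commutativeRing (centralTrinomial ((q ℕ.+ 1) / 2)) * (u * u)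
theorem1p1 q (_ , odd) q≢3 F a listing = det-S-order (odd-order F odd q≢3) F listing
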